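{- Let $A$ be a full rank $r\times n$ integer matrix ($r<n$) with greatest divisor $\delta(A)$, let $k=n-r$, and let $d>0$ be such that $\delta(A)$ divides $d$; write $d=p_1^{e_1}p_2^{e_2}\cdots p_l^{e_l}\,\delta(A)$ with $p_1,\dots,p_l$ distinct primes and $e_i\ge 1$. Then the number $N$ of fundamental solutions (equivalently, of L-A-equivalence classes of solutions of $\det\begin{bmatrix} A\\ X\end{bmatrix}=\pm d$) is $$N=\delta(A)^k\prod_{i=1}^{l}\left(\sum_{1\le j_1\le j_2\le\cdots\le j_{e_i}\le k} p_i^{\,e_i k-j_1-j_2-\cdots-j_{e_i}}\right).$$
   Context: An integer square matrix is unimodular if its determinant is $\pm1$. For a full rank integer $r\times n$ matrix $M$, $\delta(M)$ is the gcd of its $r\times r$ minors. $\begin{bmatrix} A\\ X\end{bmatrix}$ denotes the $n\times n$ matrix with the rows of $A$ above the rows of the $(n-r)\times n$ integer matrix $X$; $X$ is a solution if this determinant is $\pm d$. Two solutions $X_1,X_2$ are L-A-equivalent if $\begin{bmatrix} A\\ X_1\end{bmatrix}=W\begin{bmatrix} A\\ X_2\end{bmatrix}$ for some unimodular integer $W$. A square nonsingular integer matrix $(a_{ij})$ is in LHNF if it is lower triangular with nonnegative entries, $a_{ii}>0$ and $0\le a_{ji}<a_{ii}$ for $j>i$; in RHNF if lower triangular with nonnegative entries, $a_{ii}>0$ and $0\le a_{ij}<a_{ii}$ for $j<i$. Fundamental solutions: fix unimodular $U$ ($n\times n$) with $AU=[N\ O]$, $N$ in RHNF, and unimodular $U'$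 ($r\times r$) with $U'AU=[N'\ O]$, $N'$ in LHNF; the fundamental solutions are $BU^{ -1}$ for all $(n-r)\times n$ integer $B$ such that $\begin{bmatrix} U'AU\\ B\end{bmatrix}$ is in LHNF with the product of its diagonal entries in positions $r+1,\dots,n$ equal to $d/\delta(A)$. Distinct such $B$ give distinct, pairwise non-L-A-equivalent solutions, and every solution is L-A-equivalent to one of them. -}

module Defs where

open import Data.Nat as ℕ using (ℕ; zero; suc; _^_; _∸_)
open import Data.Nat.Divisibility using (_∣_)
open import Data.Integer as ℤ using (ℤ; +_; -_; ∣_∣)
open import Data.Fin as Fin using (Fin; zero; suc; toℕ; punchIn; splitAt)
open import Data.Sum using (_⊎_; [_,_]′)
open import Data.Product using (Σ; _×_; _,_; ∃; ∃-syntax)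
open import Data.List using (List; []; _∷_; map; concatMap; upTo)
open import Data.Nat.ListAction using (sum)
open import Relation.Binary.PropositionalEquality using (_≡_; _≢_)

Matrix : ℕ → ℕ → Set
Matrix m n = Fin m → Fin n → ℤ

sumℤ : ∀ {n} → (Fin n → ℤ) → ℤ
sumℤ {zero}  f = + 0
sumℤ {suc n} f = f zero ℤ.+ sumℤ (λ i → f (suc i))

prodℕ : ∀ {n} → (Fin n → ℕ) → ℕ
prodℕ {zero}  f = 1
prodℕ {suc n} f = f zero ℕ.* prodℕ (λ i → f (suc i))

signℤ : ℕ → ℤ
signℤ zero    = + 1
signℤ (suc j) = - signℤ j

det : ∀ {n} → Matrix n n → ℤ
det {zero}  M = + 1
det {suc n} M = sumℤ (λ j → signℤ (toℕ j) ℤ.* (M zero j ℤ.* det (λ i c → M (suc i) (punchIn j c))))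

_⊗_ : ∀ {m n p} → Matrix m n → Matrix n p → Matrix m p
(M ⊗ N) i j = sumℤ (λ l → M i l ℤ.* N l j)

Unimodular : ∀ {n} → Matrix n n → Set
Unimodular W = det W ≡ + 1 ⊎ det W ≡ - (+ 1)

ColumnChoice : ℕ → ℕ → Set
ColumnChoice r n = Σ (Fin r → Fin n) λ c → ∀ i j → i Fin.< j → c i Fin.< c j

minor : ∀ {r n} → Matrix r n → ColumnChoice r n → ℤ
minor A (c , _) = det (λ i j → A i (c j))

FullRank : ∀ {r n} → Matrix r n → Set
FullRank A = ∃[ c ] minor A c ≢ + 0

IsDelta : ∀ {r n} → Matrix r n → ℕ → Set
IsDelta A δ =
  (∀ c → δ ∣ ∣ minor A c ∣) ×
  (∀ g → (∀ c → g ∣ ∣ minor A c ∣) → g ∣ δ)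

stack : ∀ {r k} → Matrix r (r ℕ.+ k) → Matrix k (r ℕ.+ k) → Matrix (r ℕ.+ k) (r ℕ.+ k)
stack {r} A X i = [ A , X ]′ (splitAt r i)

Solution : ∀ {r k} → Matrix r (r ℕ.+ k) → ℕ → Matrix k (r ℕ.+ k) → Set
Solution A d X = det (stack A X) ≡ + d ⊎ det (stack A X) ≡ - (+ d)

LAEquiv : ∀ {r k} → Matrix r (r ℕ.+ k) → Matrix k (r ℕ.+ k) → Matrix k (r ℕ.+ k) → Set
LAEquiv {r} {k} A X₁ X₂ =
  ∃[ W ] Unimodular {r ℕ.+ k} W × (∀ i j → stack A X₁ i j ≡ (W ⊗ stack A X₂) i j)

range : ℕ → ℕ → List ℕ
range lo hi = map (lo ℕ.+_) (upTo (suc hi ∸ lo))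

nondecSeqs : ℕ → ℕ → ℕ → List (List ℕ)
nondecSeqs lo hi zero    = [] ∷ []
nondecSeqs lo hi (suc e) = concatMap (λ j → map (j ∷_) (nondecSeqs j hi e)) (range lo hi)

localFactor : ℕ → ℕ → ℕ → ℕ
localFactor p e k = sum (map (λ js → p ^ ((e ℕ.* k) ∸ sum js)) (nondecSeqs 1 k e))

countFormula : ℕ → ℕ → (l : ℕ) → (Fin l → ℕ) → (Fin l → ℕ) → ℕ
countFormula δ k l p e = (δ ^ k) ℕ.* prodℕ (λ i → localFactor (p i) (e i) k)

NumClasses : ∀ {r k} → Matrix r (r ℕ.+ k) → ℕ → ℕ → Set
NumClasses {r} {k} A d N =
  Σ (Fin N → Matrix k (r ℕ.+ k)) λ sol →
    (∀ i → Solution A d (sol i)) ×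
    (∀ i j → LAEquiv A (sol i) (sol j) → i ≡ j) ×
    (∀ X → Solution A d X → ∃[ i ] LAEquiv A X (sol i))

{-# OPTIONS --safe #-}

-- Column operations turn the first row of A into (a, 0, …, 0), and [A ; X] becomes the block matrix
-- [a 0 ; y S] with S = [A′ ; X′] of the same kind and one size smaller. Since S is nonsingular, a
-- multiplier W relating two such matrices has the form [1 0 ; u W′], so the classes for A with
-- determinant a d′ correspond to the classes for A′ with determinant d′ together with a vector in
-- (ℤ/a)^k; each row of A thus contributes a factor a^k, and δ(A) = a δ(A′). For r = 0, the first row
-- of X itself can be brought to (g, 0, …, 0) with g dividing the determinant m, so the number
-- c(k, m) of classes of k × k matrices satisfies c(k + 1, m) = Σ_{g ∣ m} g^k c(k, m / g). The
-- right-hand side is multiplicative, and on prime powers it is the recursion of the complete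
-- homogeneous symmetric polynomials h_e(1, p, …, p^(k-1)), which are the local factors.
module Submission where

open import Defs

-- The determinant is given only by expansion along the first row, so the product rule and the
-- behaviour of minors must be extracted from that. One fact about alternating forms does most of
-- it: a divisor of the values on increasing sequences of basis vectors divides every value. For the
-- divisor 0 this gives uniqueness of the determinant and hence multiplicativity; for a common
-- divisor of the minors it gives the divisibility half of Cauchy-Binet, hence the invariance of `δ`
-- under column operations. For r = 0 there is no prescribed row, and only row operations are
-- allowed. There the row (g, 0, ..., 0) comes from linear dependence: without its first column, a
-- square matrix has one row too many, so its rows satisfy a nontrivial integer relation; made
-- primitive, the relation is the first row of an invertible matrix. The resulting axis row then
-- plays the role of a one-row `A`, so the same bordering step serves both cases. The sum over g ∣ m
-- runs over splittings of the exponents instead of over numbers, so that it factors prime by prime.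

module Matrices where
  open import Data.Nat as ℕ using (ℕ; zero; suc)
  import Data.Nat.Properties as ℕ
  open import Data.Integer as ℤ using (ℤ; 0ℤ; 1ℤ; -1ℤ; _+_; _*_; -_; _-_; ∣_∣)
  open import Data.Integer.Properties
  open import Data.Integer.Divisibility.Signed as ℤ∣ using (_∣_; ∣m∣n⇒∣m+n; ∣n⇒∣m*n; ∣m⇒∣-m)
  open import Data.Integer.DivMod using (a≡a%n+[a/n]*n; n%d<d)
  open import Data.Integer.Tactic.RingSolver using (solve-∀)
  open import Data.Fin as Fin using (Fin; zero; suc; toℕ; punchIn; punchOut)
  open import Data.Fin.Properties using (punchIn-punchOut; punchInᵢ≢i; punchIn-injective; suc-injective; pigeonhole)
  open import Data.Product using (_×_; _,_; ∃-syntax; proj₁; proj₂)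
  open import Data.Sum using (_⊎_; inj₁; inj₂)
  open import Function using (_∘_)
  open import Relation.Nullary using (¬_; Dec; yes; no; contradiction)
  open import Relation.Binary.PropositionalEquality
  open ≡-Reasoning

  -- Finite sums, vectors and matrix products

  Vector : ℕ → Set
  Vector n = Fin n → ℤ

  sum-cong : ∀ {n} {f g : Vector n} → (∀ i → f i ≡ g i) → sumℤ f ≡ sumℤ g
  sum-cong {zero}  e = refl
  sum-cong {suc n} e = cong₂ _+_ (e zero) (sum-cong (e ∘ suc))

  sum-zero : ∀ {n} {f : Vector n} → (∀ i → f i ≡ 0ℤ) → sumℤ f ≡ 0ℤ
  sum-zero {zero}  e = refl
  sum-zero {suc n} e = cong₂ _+_ (e zero) (sum-zero (e ∘ suc))

  sum-+ : ∀ {n} (f g : Vector n) → sumℤ (λ i → f i + g i) ≡ sumℤ f + sumℤ g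
  sum-+ {zero}  f g = refl
  sum-+ {suc n} f g = 
    trans (cong (f zero + g zero +_) (sum-+ (f ∘ suc) (g ∘ suc)))
      (interchange (f zero) (g zero) (sumℤ (f ∘ suc)) (sumℤ (g ∘ suc)))
    where
    interchange : ∀ a b c d → a + b + (c + d) ≡ a + c + (b + d)
    interchange = solve-∀

  sum-*ˡ : ∀ {n} a (f : Vector n) → sumℤ (λ i → a * f i) ≡ a * sumℤ f
  sum-*ˡ {zero}  a f = sym (*-zeroʳ a)
  sum-*ˡ {suc n} a f = 
    trans (cong (a * f zero +_) (sum-*ˡ a (f ∘ suc))) (sym (*-distribˡ-+ a (f zero) (sumℤ (f ∘ suc))))

  sum-*ʳ : ∀ {n} (f : Vector n) a → sumℤ (λ i → f i * a) ≡ sumℤ f * a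
  sum-*ʳ f a = trans (sum-cong λ i → *-comm (f i) a) (trans (sum-*ˡ a f) (*-comm a (sumℤ f)))

  sum-swap : ∀ {m n} (f : Fin m → Fin n → ℤ) →
    sumℤ (λ i → sumℤ (f i)) ≡ sumℤ (λ j → sumℤ (λ i → f i j))
  sum-swap {zero}  {n} f = sym (sum-zero {n} λ _ → refl)
  sum-swap {suc m} {n} f =
    trans (cong (sumℤ (f zero) +_) (sum-swap (f ∘ suc))) (sym (sum-+ (f zero) (λ j → sumℤ (λ i → f (suc i) j))))

  infixl 7 _∙_ _⊛_
  _∙_ : ∀ {n} → Vector n → Vector n → ℤ
  v ∙ w = sumℤ (λ l → v l * w l)

  _⊛_ : ∀ {m n} → Vector m → Matrix m n → Vector n
  (v ⊛ M) j = v ∙ (λ l → M l j)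

  lincomb-∙ : ∀ {n} a b (u v w : Vector n) →
    (λ l → a * u l + b * v l) ∙ w ≡ a * (u ∙ w) + b * (v ∙ w)
  lincomb-∙ a b u v w = begin
    sumℤ (λ l → (a * u l + b * v l) * w l)             ≡⟨ sum-cong (λ l → distr a b (u l) (v l) (w l)) ⟩
    sumℤ (λ l → a * (u l * w l) + b * (v l * w l))     ≡⟨ sum-+ (λ l → a * (u l * w l)) (λ l → b * (v l * w l)) ⟩
    sumℤ (λ l → a * (u l * w l)) + sumℤ (λ l → b * (v l * w l))
      ≡⟨ cong₂ _+_ (sum-*ˡ a (λ l → u l * w l)) (sum-*ˡ b (λ l → v l * w l)) ⟩
    a * (u ∙ w) + b * (v ∙ w) ∎
    where
    distr : ∀ a b u v w → (a * u + b * v) * w ≡ a * (u * w) + b * (v * w)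
    distr = solve-∀

  ∙-comm : ∀ {n} (v w : Vector n) → v ∙ w ≡ w ∙ v
  ∙-comm v w = sum-cong λ l → *-comm (v l) (w l)

  ∙-zeroˡ : ∀ {n} {v : Vector n} → (∀ i → v i ≡ 0ℤ) → ∀ w → v ∙ w ≡ 0ℤ
  ∙-zeroˡ z w = sum-zero λ i → cong (_* w i) (z i)

  ∙-zeroʳ : ∀ {n} (v : Vector n) {w} → (∀ i → w i ≡ 0ℤ) → v ∙ w ≡ 0ℤ
  ∙-zeroʳ v z = sum-zero λ i → trans (cong (v i *_) (z i)) (*-zeroʳ (v i))

  ⊛-assoc : ∀ {m n p} (v : Vector m) (M : Matrix m n) (P : Matrix n p) →
    ∀ j → ((v ⊛ M) ⊛ P) j ≡ (v ⊛ (M ⊗ P)) j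
  ⊛-assoc v M P j = begin
    sumℤ (λ l → (v ⊛ M) l * P l j)                     ≡⟨ sum-cong (λ l → sym (sum-*ʳ (λ i → v i * M i l) (P l j))) ⟩
    sumℤ (λ l → sumℤ (λ i → v i * M i l * P l j))      ≡⟨ sum-swap (λ l i → v i * M i l * P l j) ⟩
    sumℤ (λ i → sumℤ (λ l → v i * M i l * P l j))      ≡⟨ sum-cong (λ i → sum-cong λ l → *-assoc (v i) (M i l) (P l j)) ⟩
    sumℤ (λ i → sumℤ (λ l → v i * (M i l * P l j)))    ≡⟨ sum-cong (λ i → sum-*ˡ (v i) (λ l → M i l * P l j)) ⟩
    (v ⊛ (M ⊗ P)) j ∎

  infix 4 _≈_
  -- Matrices are functions, so equality is taken entrywise. Wrapping it in a record keeps `M` and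
  -- `P` visible to unification, which could not recover them from unfolded sums.
  record _≈_ {m n} (M P : Matrix m n) : Set where
    constructor pointwise
    field at : ∀ i j → M i j ≡ P i j
  open _≈_ public

  ≈-refl : ∀ {m n} {M : Matrix m n} → M ≈ M
  ≈-refl = pointwise λ _ _ → refl

  ≈-sym : ∀ {m n} {M P : Matrix m n} → M ≈ P → P ≈ M
  ≈-sym e = pointwise λ i j → sym (at e i j)

  ≈-trans : ∀ {m n} {M P Q : Matrix m n} → M ≈ P → P ≈ Q → M ≈ Q
  ≈-trans e f = pointwise λ i j → trans (at e i j) (at f i j)

  ⊗-cong : ∀ {m n p} {M M′ : Matrix m n} {P P′ : Matrix n p} → M ≈ M′ → P ≈ P′ → M ⊗ P ≈ M′ ⊗ P′
  ⊗-cong e f = pointwise λ i j → sum-cong λ l → cong₂ _*_ (at e i l) (at f l j)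

  ⊗-assoc : ∀ {m n p q} (M : Matrix m n) (P : Matrix n p) (Q : Matrix p q) → (M ⊗ P) ⊗ Q ≈ M ⊗ (P ⊗ Q)
  ⊗-assoc M P Q = pointwise λ i → ⊛-assoc (M i) P Q

  I : ∀ {n} → Matrix n n
  I zero    zero    = 1ℤ
  I zero    (suc j) = 0ℤ
  I (suc i) zero    = 0ℤ
  I (suc i) (suc j) = I i j

  ∙-Iˡ : ∀ {n} (i : Fin n) w → I i ∙ w ≡ w i
  ∙-Iˡ zero    w = trans (cong₂ _+_ (*-identityˡ (w zero)) (∙-zeroˡ {v = λ _ → 0ℤ} (λ _ → refl) (w ∘ suc))) (+-identityʳ (w zero))
  ∙-Iˡ (suc i) w = trans (+-identityˡ (I i ∙ (w ∘ suc))) (∙-Iˡ i (w ∘ suc))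

  I-sym : ∀ {n} (i j : Fin n) → I i j ≡ I j i
  I-sym zero    zero    = refl
  I-sym zero    (suc j) = refl
  I-sym (suc i) zero    = refl
  I-sym (suc i) (suc j) = I-sym i j

  ⊛-identityʳ : ∀ {n} (v : Vector n) j → (v ⊛ I) j ≡ v j
  ⊛-identityʳ v j = trans (∙-comm v (λ l → I l j)) (trans (sum-cong λ l → cong (_* v l) (I-sym l j)) (∙-Iˡ j v))

  ⊗-identityˡ : ∀ {m n} (M : Matrix m n) → I ⊗ M ≈ M
  ⊗-identityˡ M = pointwise λ i j → ∙-Iˡ i (λ l → M l j)

  ⊗-identityʳ : ∀ {m n} (M : Matrix m n) → M ⊗ I ≈ M
  ⊗-identityʳ M = pointwise λ i j → ⊛-identityʳ (M i) j

  infix 25 _ᵀ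
  _ᵀ : ∀ {m n} → Matrix m n → Matrix n m
  (M ᵀ) i j = M j i

  ⊗-ᵀ : ∀ {m n p} (M : Matrix m n) (P : Matrix n p) → P ᵀ ⊗ M ᵀ ≈ (M ⊗ P) ᵀ
  ⊗-ᵀ M P = pointwise λ i j → ∙-comm (λ l → P l i) (M j)

  -- Invertible and block triangular matrices

  -- The inverse is carried as data: every invertible matrix below is built from identities, swaps,
  -- bordered matrices, products and transposes, so its inverse is always at hand.
  record Inverses {n} (W V : Matrix n n) : Set where
    field
      invʳ : W ⊗ V ≈ I
      invˡ : V ⊗ W ≈ I
  open Inverses public

  inverses-sym : ∀ {n} {W V : Matrix n n} → Inverses W V → Inverses V W
  inverses-sym u = record { invʳ = invˡ u ; invˡ = invʳ u }

  cancel-inverse : ∀ {n p} {W V : Matrix n n} → Inverses W V → (M : Matrix n p) → V ⊗ (W ⊗ M) ≈ M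
  cancel-inverse {W = W} {V} u M =
    ≈-trans (≈-sym (⊗-assoc V W M)) (≈-trans (⊗-cong (invˡ u) (≈-refl {M = M})) (⊗-identityˡ M))

  inverses-⊗ : ∀ {n} {W V W′ V′ : Matrix n n} → Inverses W V → Inverses W′ V′ → Inverses (W ⊗ W′) (V′ ⊗ V)
  inverses-⊗ {n} u u′ = record { invʳ = half u u′ ; invˡ = half (inverses-sym u′) (inverses-sym u) }
    where
    half : ∀ {W V W′ V′ : Matrix n n} → Inverses W V → Inverses W′ V′ → (W ⊗ W′) ⊗ (V′ ⊗ V) ≈ I
    half {W} {V} {W′} {V′} u u′ = ≈-trans (⊗-assoc W W′ (V′ ⊗ V))
      (≈-trans (⊗-cong (≈-refl {M = W}) (cancel-inverse (inverses-sym u′) V)) (invʳ u))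

  inverses-ᵀ : ∀ {n} {W V : Matrix n n} → Inverses W V → Inverses (W ᵀ) (V ᵀ)
  inverses-ᵀ {n} {W} {V} u = record { invʳ = half V W (invˡ u) ; invˡ = half W V (invʳ u) }
    where
    half : (V W : Matrix n n) → V ⊗ W ≈ I → W ᵀ ⊗ V ᵀ ≈ I
    half V W e = ≈-trans (⊗-ᵀ V W) (pointwise λ i j → trans (at e j i) (I-sym j i))

  -- One block shape for three purposes: stacked matrices whose first row is on the axis, elementary
  -- row operations, and the multipliers relating two stacked matrices.
  bordered : ∀ {m n} → ℤ → Vector m → Matrix m n → Matrix (suc m) (suc n)
  bordered s u W zero    zero    = s
  bordered s u W zero    (suc j) = 0ℤ
  bordered s u W (suc i) zero    = u i
  bordered s u W (suc i) (suc j) = W i j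

  infixl 7 _⋆_
  _⋆_ : ∀ {m n} → Matrix m n → Vector n → Vector m
  (W ⋆ v) i = W i ∙ v

  bordered-⊗ : ∀ {m n p} s s′ (u : Vector m) (u′ : Vector n) (W : Matrix m n) (W′ : Matrix n p) →
    bordered s u W ⊗ bordered s′ u′ W′ ≈ bordered (s * s′) (λ i → u i * s′ + (W ⋆ u′) i) (W ⊗ W′)
  bordered-⊗ s s′ u u′ W W′ = pointwise λ where
    zero    zero    → trans (cong (s * s′ +_) (∙-zeroˡ {v = λ _ → 0ℤ} (λ _ → refl) u′)) (+-identityʳ (s * s′))
    zero    (suc j) → cong₂ _+_ (*-zeroʳ s) (∙-zeroˡ {v = λ _ → 0ℤ} (λ _ → refl) (λ l → W′ l j))
    (suc i) zero    → refl
    (suc i) (suc j) → trans (cong (_+ (W ⊗ W′) i j) (*-zeroʳ (u i))) (+-identityˡ ((W ⊗ W′) i j))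

  bordered-cong : ∀ {m n s s′} {u u′ : Vector m} {W W′ : Matrix m n} →
    s ≡ s′ → (∀ i → u i ≡ u′ i) → W ≈ W′ → bordered s u W ≈ bordered s′ u′ W′
  bordered-cong e f g = pointwise λ where
    zero    zero    → e
    zero    (suc j) → refl
    (suc i) zero    → f i
    (suc i) (suc j) → at g i j

  bordered-I : ∀ {n} → bordered 1ℤ (λ _ → 0ℤ) (I {n}) ≈ I
  bordered-I = pointwise λ where
    zero    zero    → refl
    zero    (suc j) → refl
    (suc i) zero    → refl
    (suc i) (suc j) → refl

  -- The corner is a sign and thus its own inverse; the column of the inverse is the solution `u′`
  -- of `u s + W u′ = 0`.
  inverses-bordered : ∀ {n s} (u : Vector n) {W V : Matrix n n} → s * s ≡ 1ℤ → Inverses W V →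
    Inverses (bordered s u W) (bordered s (λ i → - (s * (V ⋆ u) i)) V)
  inverses-bordered {n} {s} u {W} {V} s² inv = record
    { invʳ = ≈-trans (bordered-⊗ s s u u′ W V) (≈-trans (bordered-cong s² right (invʳ inv)) bordered-I)
    ; invˡ = ≈-trans (bordered-⊗ s s u′ u V W) (≈-trans (bordered-cong s² left (invˡ inv)) bordered-I) }
    where
    u′ : Vector n
    u′ i = - (s * (V ⋆ u) i)
    neg-scale : ∀ s x y → x * - (s * y) ≡ - s * (x * y)
    neg-scale = solve-∀
    WVu : ∀ i → (W ⋆ (V ⋆ u)) i ≡ u i
    -- A vector is read as a matrix with one column, so that the laws of the matrix product apply to
    -- it.
    WVu i = at (cancel-inverse {p = 1} (inverses-sym inv) (λ i _ → u i)) i zero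
    cancel : ∀ s x → x * s + - s * x ≡ 0ℤ
    cancel = solve-∀
    right : ∀ i → u i * s + (W ⋆ u′) i ≡ 0ℤ
    right i = begin
      u i * s + (W ⋆ u′) i               ≡⟨ cong (u i * s +_) (trans (sum-cong λ l → neg-scale s (W i l) ((V ⋆ u) l)) (sum-*ˡ (- s) (λ l → W i l * (V ⋆ u) l))) ⟩
      u i * s + - s * (W ⋆ (V ⋆ u)) i    ≡⟨ cong (λ z → u i * s + - s * z) (WVu i) ⟩
      u i * s + - s * u i                ≡⟨ cancel s (u i) ⟩
      0ℤ ∎
    reassoc : ∀ s y → - (s * y) * s + y ≡ (1ℤ - s * s) * y
    reassoc = solve-∀
    left : ∀ i → u′ i * s + (V ⋆ u) i ≡ 0ℤ
    left i = trans (reassoc s ((V ⋆ u) i)) (cong (λ z → (1ℤ - z) * (V ⋆ u) i) s²)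

  -- Alternating multilinear forms in the rows of a matrix

  -- Alternation is demanded for neighbouring rows only. This is the case that a Laplace expansion
  -- handles directly; arbitrary pairs of rows follow by swapping.
  data Adjacent : ∀ {n} → Fin n → Fin n → Set where
    here  : ∀ {n} → Adjacent {suc (suc n)} zero (suc zero)
    there : ∀ {n} {i j : Fin n} → Adjacent i j → Adjacent (suc i) (suc j)

  infixr 5 _∷ᵣ_
  _∷ᵣ_ : ∀ {r n} → Vector n → Matrix r n → Matrix (suc r) n
  (v ∷ᵣ M) zero    = v
  (v ∷ᵣ M) (suc i) = M i

  ∷ᵣ-cong : ∀ {r n} {v w : Vector n} {M P : Matrix r n} → (∀ c → v c ≡ w c) → M ≈ P → v ∷ᵣ M ≈ w ∷ᵣ P
  ∷ᵣ-cong e f = pointwise λ { zero → e ; (suc i) → at f i }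

  ∷ᵣ-eta : ∀ {r n} (M : Matrix (suc r) n) → M ≈ M zero ∷ᵣ (M ∘ suc)
  ∷ᵣ-eta M = pointwise λ { zero c → refl ; (suc i) c → refl }

  -- Linearity in row `j` compares three matrices that agree off that row, which avoids an operation
  -- replacing a row.
  record Alternating {r n} (D : Matrix r n → ℤ) : Set where
    field
      respects : ∀ {M P} → M ≈ P → D M ≡ D P
      linear : ∀ j a b {M P Q} →
        (∀ i → i ≢ j → ∀ c → M i c ≡ P i c) → (∀ i → i ≢ j → ∀ c → M i c ≡ Q i c) →
        (∀ c → M j c ≡ a * P j c + b * Q j c) → D M ≡ a * D P + b * D Q
      alternates : ∀ {i j} {M} → Adjacent i j → (∀ c → M i c ≡ M j c) → D M ≡ 0ℤ
  open Alternating public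

  module _ {r n} {D : Matrix (suc r) n → ℤ} (A : Alternating D) where

    alternating-tail : ∀ v → Alternating (λ M → D (v ∷ᵣ M))
    alternating-tail v = record
      { respects = λ e → respects A (∷ᵣ-cong (λ _ → refl) e)
      ; linear = λ j a b p q e → linear A (suc j) a b
          (λ { zero _ c → refl ; (suc i) ne → p i (ne ∘ cong suc) })
          (λ { zero _ c → refl ; (suc i) ne → q i (ne ∘ cong suc) }) e
      ; alternates = λ ad → alternates A (there ad) }

    linear-head : ∀ a b {v u w} M → (∀ c → v c ≡ a * u c + b * w c) →
      D (v ∷ᵣ M) ≡ a * D (u ∷ᵣ M) + b * D (w ∷ᵣ M)
    linear-head a b M e = linear A zero a b
      (λ { zero ne → contradiction refl ne ; (suc i) _ c → refl })
      (λ { zero ne → contradiction refl ne ; (suc i) _ c → refl }) e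

  lincomb₁₁ : ∀ x y → x + y ≡ 1ℤ * x + 1ℤ * y
  lincomb₁₁ = solve-∀

  -- Polarisation: the form vanishes when both top rows are `x + y`, and of the four terms of the
  -- expansion the two with equal rows vanish as well.
  swap-sign : ∀ {r n} {D : Matrix (suc (suc r)) n → ℤ} → Alternating D →
    ∀ x y M → D (x ∷ᵣ y ∷ᵣ M) ≡ - D (y ∷ᵣ x ∷ᵣ M)
  swap-sign {D = D} A x y M = conclude (D (x ∷ᵣ x ∷ᵣ M)) (D (x ∷ᵣ y ∷ᵣ M)) (D (y ∷ᵣ x ∷ᵣ M)) (D (y ∷ᵣ y ∷ᵣ M))
    (alternates A here λ _ → refl) (alternates A here λ _ → refl) (begin
      0ℤ                                              ≡⟨ alternates A here (λ _ → refl) ⟨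
      D (x+y ∷ᵣ x+y ∷ᵣ M)                             ≡⟨ linear-head A 1ℤ 1ℤ (x+y ∷ᵣ M) split ⟩
      1ℤ * D (x ∷ᵣ x+y ∷ᵣ M) + 1ℤ * D (y ∷ᵣ x+y ∷ᵣ M) ≡⟨ cong₂ (λ s t → 1ℤ * s + 1ℤ * t) (expand x) (expand y) ⟩
      _ ∎)
    where
    x+y : Vector _
    x+y c = x c + y c
    split : ∀ c → x+y c ≡ 1ℤ * x c + 1ℤ * y c
    split c = lincomb₁₁ (x c) (y c)
    expand : ∀ z → D (z ∷ᵣ x+y ∷ᵣ M) ≡ 1ℤ * D (z ∷ᵣ x ∷ᵣ M) + 1ℤ * D (z ∷ᵣ y ∷ᵣ M)
    expand z = linear-head (alternating-tail A z) 1ℤ 1ℤ M split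
    isolate : ∀ a b c d → b ≡ 1ℤ * (1ℤ * a + 1ℤ * b) + 1ℤ * (1ℤ * c + 1ℤ * d) - a - d - c
    isolate = solve-∀
    simplify : ∀ c → 0ℤ - 0ℤ - 0ℤ - c ≡ - c
    simplify = solve-∀
    conclude : ∀ a b c d → a ≡ 0ℤ → d ≡ 0ℤ → 0ℤ ≡ 1ℤ * (1ℤ * a + 1ℤ * b) + 1ℤ * (1ℤ * c + 1ℤ * d) → b ≡ - c
    conclude a b c d a≡0 d≡0 e =
      trans (isolate a b c d) (trans (cong₂ (λ u v → u - v - d - c) (sym e) a≡0)
        (trans (cong (λ v → 0ℤ - 0ℤ - v - c) d≡0) (simplify c)))

  -- The row `v` climbs to the top by swaps of neighbours, each costing only a sign. The induction
  -- fixes the top row and passes to the form in the remaining ones.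
  divides-with-row : ∀ {r n g} {D : Matrix (suc r) n → ℤ} → Alternating D → ∀ v →
    (∀ M → g ∣ D (v ∷ᵣ M)) → ∀ j M → (∀ c → M j c ≡ v c) → g ∣ D M
  divides-with-row {g = g} A v h zero M e =
    subst (g ∣_) (sym (respects A (≈-trans (∷ᵣ-eta M) (∷ᵣ-cong e ≈-refl)))) (h (M ∘ suc))
  divides-with-row {suc r} {g = g} {D} A v h (suc j) M e =
    subst (g ∣_) (sym (respects A (∷ᵣ-eta M)))
      (divides-with-row (alternating-tail A (M zero)) v swapped j (M ∘ suc) e)
    where
    swapped : ∀ P → g ∣ D (M zero ∷ᵣ v ∷ᵣ P)
    swapped P = subst (g ∣_) (sym (swap-sign A (M zero) v P)) (∣m⇒∣-m (h (M zero ∷ᵣ P)))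

  e₀ : ∀ {n} → Vector (suc n)
  e₀ zero    = 1ℤ
  e₀ (suc _) = 0ℤ

  pad : ∀ {n} → Vector n → Vector (suc n)
  pad w zero    = 0ℤ
  pad w (suc c) = w c

  padRows : ∀ {r n} → Matrix r n → Matrix r (suc n)
  padRows M i = pad (M i)

  tails : ∀ {r n} → Matrix r (suc n) → Matrix r n
  tails M i c = M i (suc c)

  -- Each row is a multiple of `e₀` plus a row with vanishing first entry. After multilinear
  -- expansion, a term either contains the row `e₀` or consists of padded rows.
  divides-by-tails : ∀ {r n g} {D : Matrix r (suc n) → ℤ} → Alternating D →
    (∀ j M → (∀ c → M j c ≡ e₀ c) → g ∣ D M) → (∀ M → g ∣ D (padRows M)) → ∀ M → g ∣ D M
  divides-by-tails {zero} {g = g} A h₀ h M = subst (g ∣_) (respects A (pointwise λ ())) (h (tails M))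
  divides-by-tails {suc r} {g = g} {D} A h₀ h M = subst (g ∣_) (sym (respects A (∷ᵣ-eta M)))
    (subst (g ∣_) (sym split)
      (∣m∣n⇒∣m+n (∣n⇒∣m*n (M zero zero) (h₀ zero _ λ _ → refl)) (∣n⇒∣m*n 1ℤ rest)))
    where
    w : Vector _
    w = pad (λ c → M zero (suc c))
    head-split : ∀ a → a ≡ a * 1ℤ + 1ℤ * 0ℤ
    head-split = solve-∀
    tail-split : ∀ a b → b ≡ a * 0ℤ + 1ℤ * b
    tail-split = solve-∀
    split : D (M zero ∷ᵣ (M ∘ suc)) ≡ M zero zero * D (e₀ ∷ᵣ (M ∘ suc)) + 1ℤ * D (w ∷ᵣ (M ∘ suc))
    split = linear-head A (M zero zero) 1ℤ (M ∘ suc) λ where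
      zero    → head-split (M zero zero)
      (suc c) → tail-split (M zero zero) (M zero (suc c))
    rest : g ∣ D (w ∷ᵣ (M ∘ suc))
    rest = divides-by-tails (alternating-tail A w) (λ j P → h₀ (suc j) (w ∷ᵣ P))
      (λ P → subst (g ∣_) (respects A (pointwise λ { zero _ → refl ; (suc i) _ → refl })) (h ((λ c → M zero (suc c)) ∷ᵣ P)))
      (M ∘ suc)

  alternating-pad : ∀ {r n} {D : Matrix r (suc n) → ℤ} → Alternating D → Alternating (λ M → D (padRows M))
  alternating-pad A = record
    { respects = λ e → respects A (pointwise λ { i zero → refl ; i (suc c) → at e i c })
    ; linear = λ j a b {M} {P} {Q} p q e → linear A j a b
        (λ { i ne zero → refl ; i ne (suc c) → p i ne c })
        (λ { i ne zero → refl ; i ne (suc c) → q i ne c })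
        (λ { zero → zero-comb a b ; (suc c) → e c })
    ; alternates = λ ad e → alternates A ad λ { zero → refl ; (suc c) → e c } }
    where
    zero-comb : ∀ a b → 0ℤ ≡ a * 0ℤ + b * 0ℤ
    zero-comb = solve-∀

  shiftChoice : ∀ {r n} → ColumnChoice r n → ColumnChoice r (suc n)
  shiftChoice (c , inc) = suc ∘ c , λ i j i<j → ℕ.s≤s (inc i j i<j)

  consChoice : ∀ {r n} → ColumnChoice r n → ColumnChoice (suc r) (suc n)
  consChoice {r} {n} (c , inc) = c′ , inc′
    where
    c′ : Fin (suc r) → Fin (suc n)
    c′ zero    = zero
    c′ (suc i) = suc (c i)
    inc′ : ∀ i j → i Fin.< j → c′ i Fin.< c′ j
    inc′ zero    (suc j) _           = ℕ.s≤s ℕ.z≤n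
    inc′ (suc i) (suc j) (ℕ.s≤s i<j) = ℕ.s≤s (inc i j i<j)

  rowsI : ∀ {r n} → ColumnChoice r n → Matrix r n
  rowsI (c , _) i = I (c i)

  -- For g = 0 this says that an alternating form is determined by its values on increasing
  -- sequences of basis vectors.
  alternating-divides : ∀ {r} n {g} {D : Matrix r n → ℤ} → Alternating D →
    (∀ c → g ∣ D (rowsI c)) → ∀ M → g ∣ D M
  alternating-divides {zero} zero {g} A h M = subst (g ∣_) (respects A (pointwise λ ())) (h ((λ ()) , λ ()))
  alternating-divides {suc r} zero {g} {D} A h M = subst (g ∣_) (sym vanish) (∣n⇒∣m*n 0ℤ ℤ∣.∣-refl)
    where
    vanish : D M ≡ 0ℤ * g
    -- Without columns, any row is vacuously 0 times itself plus 0 times itself.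
    vanish = trans (linear A zero 0ℤ 0ℤ {M} {M} {M} (λ _ _ ()) (λ _ _ ()) λ ()) (refl {x = 0ℤ})
  alternating-divides {r} (suc n) {g} {D} A h M = divides-by-tails A with-e₀
    (alternating-divides n (alternating-pad A) λ c → subst (g ∣_) (respects A (shift-rows c)) (h (shiftChoice c))) M
    where
    shift-rows : ∀ {r} (c : ColumnChoice r n) → rowsI (shiftChoice c) ≈ padRows (rowsI c)
    shift-rows c = pointwise λ { i zero → refl ; i (suc _) → refl }
    with-e₀ : ∀ j M → (∀ c → M j c ≡ e₀ c) → g ∣ D M
    with-e₀ = go r A h
      where
      go : ∀ r {D : Matrix r (suc n) → ℤ} → Alternating D → (∀ c → g ∣ D (rowsI c)) →
        ∀ j M → (∀ c → M j c ≡ e₀ c) → g ∣ D M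
      -- With `e₀` moved to the top, a second row `e₀` makes the form vanish, so the other rows may
      -- be taken to be padded; these are handled in one dimension less.
      go (suc r) {D} A h = divides-with-row A e₀ (divides-by-tails tail-form repeated padded)
        where
        tail-form : Alternating (λ P → D (e₀ ∷ᵣ P))
        tail-form = alternating-tail A e₀
        vanish-repeated : ∀ {r} {D : Matrix (suc r) (suc n) → ℤ} → Alternating D →
          ∀ v j P → (∀ c → P j c ≡ v c) → D (v ∷ᵣ P) ≡ 0ℤ
        vanish-repeated {suc r} A v j P e = ℤ∣.0∣⇒≡0 (divides-with-row (alternating-tail A v) v
          (λ Q → subst (0ℤ ∣_) (sym (alternates A here λ _ → refl)) ℤ∣.∣-refl) j P e)
        repeated : ∀ j P → (∀ c → P j c ≡ e₀ c) → g ∣ D (e₀ ∷ᵣ P)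
        repeated j P e = subst (g ∣_) (sym (vanish-repeated A e₀ j P e)) (∣n⇒∣m*n 0ℤ ℤ∣.∣-refl)
        padded : ∀ P → g ∣ D (e₀ ∷ᵣ padRows P)
        padded = alternating-divides n (alternating-pad tail-form) λ c →
          subst (g ∣_) (respects A (pointwise λ { zero zero → refl ; zero (suc _) → refl ; (suc i) zero → refl ; (suc i) (suc _) → refl }))
            (h (consChoice c))

  -- The determinant as an alternating form in the columns

  -- The minors in the expansion of `det (M ᵀ)`, transposed back: forms take rows as arguments,
  -- while the first-row expansion deletes columns.
  cut : ∀ {n} → Fin (suc n) → Matrix (suc n) (suc n) → Matrix n n
  cut l M c i = M (punchIn l c) (suc i)

  det-cong : ∀ {n} {M P : Matrix n n} → M ≈ P → det M ≡ det P
  det-cong {zero}  e = refl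
  det-cong {suc n} e = sum-cong λ j → cong (signℤ (toℕ j) *_)
    (cong₂ _*_ (at e zero j) (det-cong (pointwise λ i c → at e (suc i) (punchIn j c))))

  punchIn-preimage : ∀ {n} {l i : Fin (suc n)} → l ≢ i → ∃[ i′ ] punchIn l i′ ≡ i
  punchIn-preimage l≢i = punchOut l≢i , punchIn-punchOut l≢i

  adjacent-preimage : ∀ {n} {i j : Fin (suc n)} (l : Fin (suc n)) → Adjacent i j → l ≢ i → l ≢ j →
    ∃[ i′ ] ∃[ j′ ] Adjacent i′ j′ × punchIn l i′ ≡ i × punchIn l j′ ≡ j
  adjacent-preimage zero    here       l≢i l≢j = contradiction refl l≢i
  adjacent-preimage zero    (there ad) l≢i l≢j = _ , _ , ad , refl , refl
  adjacent-preimage (suc zero) here    l≢i l≢j = contradiction refl l≢j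
  adjacent-preimage {suc (suc n)} (suc (suc l)) here l≢i l≢j = zero , suc zero , here , refl , refl
  adjacent-preimage {suc n} (suc l) (there ad) l≢i l≢j
    with i′ , j′ , ad′ , p , q ← adjacent-preimage l ad (l≢i ∘ cong suc) (l≢j ∘ cong suc) =
    suc i′ , suc j′ , there ad′ , cong suc p , cong suc q

  sum-adjacent : ∀ {n} {i j : Fin n} (f : Vector n) → Adjacent i j →
    (∀ l → l ≢ i → l ≢ j → f l ≡ 0ℤ) → f i + f j ≡ 0ℤ → sumℤ f ≡ 0ℤ
  sum-adjacent f here z e = begin
    f zero + (f (suc zero) + sumℤ (λ l → f (suc (suc l))))
      ≡⟨ cong (λ s → f zero + (f (suc zero) + s)) (sum-zero λ l → z (suc (suc l)) (λ ()) (λ ())) ⟩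
    f zero + (f (suc zero) + 0ℤ)  ≡⟨ cong (f zero +_) (+-identityʳ (f (suc zero))) ⟩
    f zero + f (suc zero)         ≡⟨ e ⟩
    0ℤ ∎
  sum-adjacent f (there ad) z e = cong₂ _+_ (z zero (λ ()) (λ ()))
    (sum-adjacent (f ∘ suc) ad (λ l p q → z (suc l) (p ∘ suc-injective) (q ∘ suc-injective)) e)

  toℕ-adjacent : ∀ {n} {i j : Fin n} → Adjacent i j → toℕ j ≡ suc (toℕ i)
  toℕ-adjacent here       = refl
  toℕ-adjacent (there ad) = cong suc (toℕ-adjacent ad)

  -- The reason why the two surviving terms of an expansion with equal neighbouring columns carry
  -- the same minor.
  punchIn-adjacent : ∀ {n} {A : Set} {i j : Fin (suc n)} (f : Fin (suc n) → A) → Adjacent i j → f i ≡ f j →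
    ∀ c → f (punchIn i c) ≡ f (punchIn j c)
  punchIn-adjacent f here       e zero    = sym e
  punchIn-adjacent f here       e (suc c) = refl
  punchIn-adjacent f (there ad) e zero    = refl
  punchIn-adjacent {suc n} f (there ad) e (suc c) = punchIn-adjacent (f ∘ suc) ad e c

  -- In the expansion, the term at `j` is linear through its entry and every other term through its
  -- minor. If columns `i` and `j` are equal neighbours, all other minors still contain both and
  -- vanish, and the two remaining terms cancel by their signs.
  det-columns-alternating : ∀ {n} → Alternating {n} {n} (λ M → det (M ᵀ))
  det-columns-alternating {zero} = record
    { respects = λ _ → refl ; linear = λ () ; alternates = λ () }
  det-columns-alternating {suc n} = record
    { respects = λ e → det-cong (pointwise λ i j → at e j i)
    ; linear = lin
    ; alternates = alt }
    where
    D : Matrix n n → ℤ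
    D M = det (M ᵀ)
    IH : Alternating D
    IH = det-columns-alternating
    term : Matrix (suc n) (suc n) → Fin (suc n) → ℤ
    term M l = signℤ (toℕ l) * (M l zero * D (cut l M))
    entry-linear : ∀ a b s p q d → s * ((a * p + b * q) * d) ≡ a * (s * (p * d)) + b * (s * (q * d))
    entry-linear = solve-∀
    cut-linear : ∀ a b s m x y → s * (m * (a * x + b * y)) ≡ a * (s * (m * x)) + b * (s * (m * y))
    cut-linear = solve-∀
    lin : ∀ j a b {M P Q : Matrix (suc n) (suc n)} →
      (∀ i → i ≢ j → ∀ c → M i c ≡ P i c) → (∀ i → i ≢ j → ∀ c → M i c ≡ Q i c) →
      (∀ c → M j c ≡ a * P j c + b * Q j c) → sumℤ (term M) ≡ a * sumℤ (term P) + b * sumℤ (term Q)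
    lin j a b {M} {P} {Q} p q e = begin
      sumℤ (term M)                                              ≡⟨ sum-cong termwise ⟩
      sumℤ (λ l → a * term P l + b * term Q l)                   ≡⟨ sum-+ (λ l → a * term P l) (λ l → b * term Q l) ⟩
      sumℤ (λ l → a * term P l) + sumℤ (λ l → b * term Q l)      ≡⟨ cong₂ _+_ (sum-*ˡ a (term P)) (sum-*ˡ b (term Q)) ⟩
      a * sumℤ (term P) + b * sumℤ (term Q) ∎
      where
      termwise : ∀ l → term M l ≡ a * term P l + b * term Q l
      termwise l with l Fin.≟ j
      ... | yes refl = begin
        s * (M l zero * D (cut l M))                           ≡⟨ cong (λ m → s * (m * D (cut l M))) (e zero) ⟩
        s * ((a * P l zero + b * Q l zero) * D (cut l M))      ≡⟨ entry-linear a b s (P l zero) (Q l zero) (D (cut l M)) ⟩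
        a * (s * (P l zero * D (cut l M))) + b * (s * (Q l zero * D (cut l M)))
          ≡⟨ cong₂ (λ x y → a * (s * (P l zero * x)) + b * (s * (Q l zero * y)))
               (respects IH (pointwise λ c i → p (punchIn l c) (punchInᵢ≢i l c) (suc i)))
               (respects IH (pointwise λ c i → q (punchIn l c) (punchInᵢ≢i l c) (suc i))) ⟩
        a * term P l + b * term Q l ∎
        where s = signℤ (toℕ l)
      ... | no l≢j with j′ , refl ← punchIn-preimage l≢j = begin
        s * (M l zero * D (cut l M))
          ≡⟨ cong (λ x → s * (M l zero * x)) (linear IH j′ a b
               (λ i i≢j′ c → p (punchIn l i) (i≢j′ ∘ punchIn-injective l i j′) (suc c))
               (λ i i≢j′ c → q (punchIn l i) (i≢j′ ∘ punchIn-injective l i j′) (suc c))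
               (e ∘ suc)) ⟩
        s * (M l zero * (a * D (cut l P) + b * D (cut l Q)))
          ≡⟨ cut-linear a b s (M l zero) (D (cut l P)) (D (cut l Q)) ⟩
        a * (s * (M l zero * D (cut l P))) + b * (s * (M l zero * D (cut l Q)))
          ≡⟨ cong₂ (λ x y → a * (s * (x * D (cut l P))) + b * (s * (y * D (cut l Q)))) (p l l≢j zero) (q l l≢j zero) ⟩
        a * term P l + b * term Q l ∎
        where s = signℤ (toℕ l)
    zero-factor : ∀ s m → s * (m * 0ℤ) ≡ 0ℤ
    zero-factor = solve-∀
    opposite : ∀ s x → s * x + - s * x ≡ 0ℤ
    opposite = solve-∀
    alt : ∀ {i j} {M : Matrix (suc n) (suc n)} → Adjacent i j → (∀ c → M i c ≡ M j c) → sumℤ (term M) ≡ 0ℤ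
    alt {i} {j} {M} ad e = sum-adjacent (term M) ad others pair
      where
      others : ∀ l → l ≢ i → l ≢ j → term M l ≡ 0ℤ
      others l l≢i l≢j with i′ , j′ , ad′ , refl , refl ← adjacent-preimage l ad l≢i l≢j =
        trans (cong (λ x → signℤ (toℕ l) * (M l zero * x)) (alternates IH ad′ (e ∘ suc)))
          (zero-factor (signℤ (toℕ l)) (M l zero))
      pair : term M i + term M j ≡ 0ℤ
      pair = trans (cong (term M i +_) (cong₂ _*_ (cong signℤ (toℕ-adjacent ad))
          (sym (cong₂ _*_ (e zero) (respects IH (pointwise λ c k → punchIn-adjacent (λ z → M z (suc k)) ad (e (suc k)) c))))))
        (opposite (signℤ (toℕ i)) (M i zero * D (cut i M)))

  det-first-row : ∀ {n} (M : Matrix (suc n) (suc n)) → (∀ j → M zero (suc j) ≡ 0ℤ) →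
    det M ≡ M zero zero * det (λ i j → M (suc i) (suc j))
  det-first-row M z = begin
    1ℤ * (M zero zero * d) + sumℤ rest  ≡⟨ cong₂ _+_ (*-identityˡ (M zero zero * d)) (sum-zero vanish) ⟩
    M zero zero * d + 0ℤ                ≡⟨ +-identityʳ (M zero zero * d) ⟩
    M zero zero * d ∎
    where
    d : ℤ
    d = det (λ i j → M (suc i) (suc j))
    rest : Vector _
    rest j = signℤ (toℕ (suc j)) * (M zero (suc j) * det (λ i c → M (suc i) (punchIn (suc j) c)))
    vanish : ∀ j → rest j ≡ 0ℤ
    vanish j = trans (cong (λ x → signℤ (toℕ (suc j)) * (x * det (λ i c → M (suc i) (punchIn (suc j) c)))) (z j))
      (*-zeroʳ (signℤ (toℕ (suc j))))

  det-I : ∀ n → det (I {n}) ≡ 1ℤ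
  det-I zero    = refl
  det-I (suc n) = trans (det-first-row (I {suc n}) λ _ → refl) (trans (*-identityˡ (det (I {n}))) (det-I n))

  alternating-∘ : ∀ {r m n} {D : Matrix r m → ℤ} → Alternating D → (P : Matrix n m) →
    Alternating (λ (M : Matrix r n) → D (M ⊗ P))
  alternating-∘ A P = record
    { respects = λ e → respects A (⊗-cong e ≈-refl)
    ; linear = λ j a b {M} {S} {T} p q e → linear A j a b
        (λ i ne c → sum-cong λ l → cong (_* P l c) (p i ne l))
        (λ i ne c → sum-cong λ l → cong (_* P l c) (q i ne l))
        (λ c → trans (sum-cong λ l → cong (_* P l c) (e l)) (lincomb-∙ a b (S j) (T j) (λ l → P l c)))
    ; alternates = λ ad e → alternates A ad λ c → sum-cong λ l → cong (_* P l c) (e l) }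

  alternating-lincomb : ∀ {r n} {D E : Matrix r n → ℤ} → Alternating D → Alternating E → ∀ k →
    Alternating (λ M → D M + k * E M)
  alternating-lincomb {D = D} {E} A B k = record
    { respects = λ e → cong₂ (λ x y → x + k * y) (respects A e) (respects B e)
    ; linear = λ j a b {M} {P} {Q} p q e →
        trans (cong₂ (λ x y → x + k * y) (linear A j a b p q e) (linear B j a b p q e))
          (regroup k a b (D P) (D Q) (E P) (E Q))
    ; alternates = λ ad e → trans (cong₂ (λ x y → x + k * y) (alternates A ad e) (alternates B ad e)) (vanish k) }
    where
    regroup : ∀ k a b x y z w → a * x + b * y + k * (a * z + b * w) ≡ a * (x + k * z) + b * (y + k * w)
    regroup = solve-∀
    vanish : ∀ k → 0ℤ + k * 0ℤ ≡ 0ℤ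
    vanish = solve-∀

  unpad : ∀ {n} (x : Fin (suc n)) → 0 ℕ.< toℕ x → ∃[ y ] x ≡ suc y
  unpad (suc y) _ = y , refl

  -- In an increasing sequence only the first entry can be `zero`, so the two cases are decided by
  -- `c zero`; they recover the cases in the induction of `alternating-divides`.
  choice-view : ∀ {r n} (c : ColumnChoice (suc r) (suc n)) →
    (∃[ c′ ] ∀ i → proj₁ c i ≡ proj₁ (consChoice {r} {n} c′) i) ⊎
    (∃[ c′ ] ∀ i → proj₁ c i ≡ proj₁ (shiftChoice {suc r} {n} c′) i)
  choice-view {r} {n} (c , inc) with c zero in c₀
  ... | zero = inj₁ ((proj₁ ∘ below , λ i j i<j → increasing (below i) (below j) (inc (suc i) (suc j) (ℕ.s≤s i<j)))
                    , λ { zero → c₀ ; (suc i) → proj₂ (below i) })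
    where
    below : ∀ i → ∃[ y ] c (suc i) ≡ suc y
    below i = unpad (c (suc i)) (subst (λ z → toℕ z ℕ.< toℕ (c (suc i))) c₀ (inc zero (suc i) (ℕ.s≤s ℕ.z≤n)))
    increasing : ∀ {x x′ : Fin (suc n)} (p : ∃[ y ] x ≡ suc y) (q : ∃[ y ] x′ ≡ suc y) →
      x Fin.< x′ → proj₁ p Fin.< proj₁ q
    increasing (_ , refl) (_ , refl) (ℕ.s≤s lt) = lt
  ... | suc y₀ = inj₂ ((proj₁ ∘ below , λ i j i<j → increasing (below i) (below j) (inc i j i<j)) , proj₂ ∘ below)
    where
    below : ∀ i → ∃[ y ] c i ≡ suc y
    below zero    = y₀ , c₀
    below (suc i) = unpad (c (suc i)) (ℕ.≤-<-trans ℕ.z≤n (inc zero (suc i) (ℕ.s≤s ℕ.z≤n)))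
    increasing : ∀ {x x′ : Fin (suc n)} (p : ∃[ y ] x ≡ suc y) (q : ∃[ y ] x′ ≡ suc y) →
      x Fin.< x′ → proj₁ p Fin.< proj₁ q
    increasing (_ , refl) (_ , refl) (ℕ.s≤s lt) = lt

  increasing-endo : ∀ {n} (c : ColumnChoice n n) i → proj₁ c i ≡ i
  increasing-endo {suc n} c i with choice-view c
  ... | inj₁ (c′ , e) = trans (e i) (cons-id i)
    where
    cons-id : ∀ i → proj₁ (consChoice c′) i ≡ i
    cons-id zero    = refl
    cons-id (suc i) = cong suc (increasing-endo c′ i)
  -- If `zero` were omitted, an increasing map would go to a smaller set, which the pigeonhole
  -- principle forbids.
  ... | inj₂ ((c′ , inc′) , _) with j , k , j<k , e ← pigeonhole (ℕ.n<1+n n) c′ =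
    contradiction (inc′ j k j<k) (ℕ.<-irrefl (cong toℕ e))

  -- The difference of the two sides is alternating and vanishes at `I`, the only increasing choice
  -- of n among n basis vectors. Vanishing is expressed as divisibility by 0.
  alternating-unique : ∀ {n} {D : Matrix n n → ℤ} → Alternating D → ∀ M → D M ≡ D I * det (M ᵀ)
  alternating-unique {n} {D} A M = from-zero (D M) (D I) (det (M ᵀ))
    (ℤ∣.0∣⇒≡0 (alternating-divides n difference vanish M))
    where
    difference : Alternating (λ M → D M + - D I * det (M ᵀ))
    difference = alternating-lincomb A det-columns-alternating (- D I)
    cancel : ∀ d → d + - d * 1ℤ ≡ 0ℤ
    cancel = solve-∀
    rows-I : ∀ c → rowsI c ≈ I
    rows-I c = pointwise λ i j → cong (λ x → I x j) (increasing-endo c i)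
    vanish : ∀ c → 0ℤ ∣ D (rowsI c) + - D I * det (rowsI c ᵀ)
    vanish c = subst (0ℤ ∣_) (sym (begin
      D (rowsI c) + - D I * det (rowsI c ᵀ)  ≡⟨ respects difference {P = I} (rows-I c) ⟩
      D I + - D I * det (I {n} ᵀ)            ≡⟨ cong (λ x → D I + - D I * x) (trans (det-cong (pointwise {n = n} {M = I ᵀ} λ i j → I-sym j i)) (det-I n)) ⟩
      D I + - D I * 1ℤ                       ≡⟨ cancel (D I) ⟩
      0ℤ ∎)) ℤ∣.∣-refl
    complete : ∀ x d y → x ≡ (x + - d * y) + d * y
    complete = solve-∀
    from-zero : ∀ x d y → x + - d * y ≡ 0ℤ → x ≡ d * y
    from-zero x d y e = trans (complete x d y) (trans (cong (_+ d * y) e) (+-identityˡ (d * y)))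

  -- For fixed M, det (M ⊗ P) is alternating in the columns of P.
  det-⊗ : ∀ {n} (M P : Matrix n n) → det (M ⊗ P) ≡ det M * det P
  det-⊗ M P = begin
    det (M ⊗ P)                        ≡⟨ det-cong (pointwise λ i j → at (⊗-ᵀ M P) j i) ⟨
    det ((P ᵀ ⊗ M ᵀ) ᵀ)                ≡⟨ alternating-unique (alternating-∘ det-columns-alternating (M ᵀ)) (P ᵀ) ⟩
    det ((I ⊗ M ᵀ) ᵀ) * det P          ≡⟨ cong (_* det P) (det-cong (pointwise λ i j → at (⊗-identityˡ (M ᵀ)) j i)) ⟩
    det M * det P ∎

  -- As a form in the columns of `U`, `det (A ⊗ U)` is alternating, and its values on increasing
  -- basis vectors are the minors of `A`. The full Cauchy-Binet sum is thereby bypassed.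
  minors-divide : ∀ {r n} {A : Matrix r n} {g} → (∀ c → g ∣ minor A c) → (U : Matrix n r) → g ∣ det (A ⊗ U)
  minors-divide {n = n} {A} {g} h U = subst (g ∣_) (det-cong (pointwise λ i j → at (⊗-ᵀ A U) j i))
    (alternating-divides n (alternating-∘ det-columns-alternating (A ᵀ)) (λ c →
      subst (g ∣_) (det-cong (pointwise λ i j → sym (∙-Iˡ (proj₁ c j) (A i)))) (h c)) (U ᵀ))

  det-invertible : ∀ {n} {W V : Matrix n n} → Inverses W V → ∣ det W ∣ ≡ 1
  det-invertible {n} {W} {V} inv = ℕ.m*n≡1⇒m≡1 ∣ det W ∣ ∣ det V ∣ (begin
    ∣ det W ∣ ℕ.* ∣ det V ∣  ≡⟨ abs-* (det W) (det V) ⟨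
    ∣ det W * det V ∣        ≡⟨ cong ∣_∣ (det-⊗ W V) ⟨
    ∣ det (W ⊗ V) ∣          ≡⟨ cong ∣_∣ (trans (det-cong (invʳ inv)) (det-I n)) ⟩
    1 ∎)

  abs-det-⊗ : ∀ {n} (M P : Matrix n n) → ∣ det (M ⊗ P) ∣ ≡ ∣ det M ∣ ℕ.* ∣ det P ∣
  abs-det-⊗ M P = trans (cong ∣_∣ (det-⊗ M P)) (abs-* (det M) (det P))

  -- Reduction of integer vectors to an axis

  ⋆-assoc : ∀ {m n p} (W : Matrix m n) (W′ : Matrix n p) v → ∀ i → ((W ⊗ W′) ⋆ v) i ≡ (W ⋆ (W′ ⋆ v)) i
  ⋆-assoc W W′ v i = at (⊗-assoc {q = 1} W W′ (λ i _ → v i)) i zero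

  ⊛-cong : ∀ {m n} {v w : Vector m} {M : Matrix m n} → (∀ i → v i ≡ w i) → ∀ j → (v ⊛ M) j ≡ (w ⊛ M) j
  ⊛-cong {M = M} e j = sum-cong λ l → cong (_* M l j) (e l)

  infix 4 _⟿_
  -- The orbit relation of invertible integer matrices on column vectors, with the matrix retained
  -- because its rows are used later.
  record _⟿_ {n} (v w : Vector n) : Set where
    constructor via
    field
      {mat inv} : Matrix n n
      invertible : Inverses mat inv
      maps : ∀ i → (mat ⋆ v) i ≡ w i

  inverses-I : ∀ {n} → Inverses (I {n}) I
  inverses-I = record { invʳ = ⊗-identityˡ I ; invˡ = ⊗-identityˡ I }

  ⟿-pointwise : ∀ {n} {v w : Vector n} → (∀ i → v i ≡ w i) → v ⟿ w
  ⟿-pointwise {v = v} e = via inverses-I λ i → trans (∙-Iˡ i v) (e i)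

  ⟿-trans : ∀ {n} {u v w : Vector n} → u ⟿ v → v ⟿ w → u ⟿ w
  ⟿-trans {u = u} (via {W} inv e) (via {W′} inv′ e′) = via (inverses-⊗ inv′ inv) λ i →
    trans (⋆-assoc W′ W u i) (trans (sum-cong λ l → cong (W′ i l *_) (e l)) (e′ i))

  infixr 5 _∷ᵥ_
  _∷ᵥ_ : ∀ {n} → ℤ → Vector n → Vector (suc n)
  (x ∷ᵥ v) zero    = x
  (x ∷ᵥ v) (suc i) = v i

  0ᵥ : ∀ {n} → Vector n
  0ᵥ _ = 0ℤ

  ⟿-bordered : ∀ {n s} {W V : Matrix n n} x v (u : Vector n) → s * s ≡ 1ℤ → Inverses W V →
    x ∷ᵥ v ⟿ (s * x) ∷ᵥ (λ i → u i * x + (W ⋆ v) i)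
  ⟿-bordered {s = s} x v u s² inv = via (inverses-bordered {s = s} u s² inv) λ where
    zero    → trans (cong (s * x +_) (∙-zeroˡ {v = 0ᵥ} (λ _ → refl) v)) (+-identityʳ (s * x))
    (suc i) → refl

  σ : ∀ {n} → Fin (suc (suc n)) → Fin (suc (suc n))
  σ zero          = suc zero
  σ (suc zero)    = zero
  σ (suc (suc i)) = suc (suc i)

  σ-involutive : ∀ {n} (i : Fin (suc (suc n))) → σ (σ i) ≡ i
  σ-involutive zero          = refl
  σ-involutive (suc zero)    = refl
  σ-involutive (suc (suc i)) = refl

  ⟿-swap : ∀ {n} (v : Vector (suc (suc n))) → v ⟿ v ∘ σ
  ⟿-swap {n} v = via {mat = S} {inv = S} record { invʳ = S² ; invˡ = S² } (λ i → ∙-Iˡ (σ i) v)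
    where
    S : Matrix (suc (suc n)) (suc (suc n))
    S i = I (σ i)
    S² : S ⊗ S ≈ I
    S² = pointwise λ i j → trans (∙-Iˡ (σ i) (λ l → S l j)) (cong (λ k → I k j) (σ-involutive i))

  abstract
    -- The Euclidean algorithm: a multiple of `x` is subtracted from `b` and the two entries are
    -- swapped, so that the new leading entry is a remainder below `∣ x ∣`; `fuel` bounds that
    -- absolute value.
    euclid : ∀ {n} fuel x b → ∣ x ∣ ℕ.< fuel → ∃[ a ] x ∷ᵥ b ∷ᵥ 0ᵥ {n} ⟿ a ∷ᵥ 0ᵥ
    euclid {n} (suc fuel) x b lt with x ≟ 0ℤ
    ... | yes refl = b , ⟿-trans (⟿-swap (0ℤ ∷ᵥ b ∷ᵥ 0ᵥ)) (⟿-pointwise λ where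
      zero          → refl
      (suc zero)    → refl
      (suc (suc i)) → refl)
    ... | no x≢0 = a , ⟿-trans reduce (⟿-trans (⟿-swap (x ∷ᵥ ρ ∷ᵥ 0ᵥ)) (⟿-trans (⟿-pointwise swapped) rest))
      where
      instance
        x-nonZero : ℤ.NonZero x
        x-nonZero = ℤ.≢-nonZero x≢0
      q ρ : ℤ
      q = b ℤ./ x
      ρ = ℤ.+ (b ℤ.% x)
      recurse : ∃[ a ] ρ ∷ᵥ x ∷ᵥ 0ᵥ {n} ⟿ a ∷ᵥ 0ᵥ
      recurse = euclid fuel ρ x (ℕ.<-≤-trans (n%d<d b x) (ℕ.s≤s⁻¹ lt))
      a : ℤ
      a = proj₁ recurse
      rest : ρ ∷ᵥ x ∷ᵥ 0ᵥ {n} ⟿ a ∷ᵥ 0ᵥ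
      rest = proj₂ recurse
      subtract : ∀ x r q → - q * x + (r + q * x) ≡ r
      subtract = solve-∀
      reduced : ∀ i → ((- q) ∷ᵥ 0ᵥ {n}) i * x + (I ⋆ (b ∷ᵥ 0ᵥ)) i ≡ (ρ ∷ᵥ 0ᵥ {n}) i
      reduced zero    = trans (cong (- q * x +_) (trans (∙-Iˡ {suc n} zero (b ∷ᵥ 0ᵥ)) (a≡a%n+[a/n]*n b x))) (subtract x ρ q)
      reduced (suc i) = trans (+-identityˡ ((I {suc n} ⋆ (b ∷ᵥ 0ᵥ)) (suc i))) (∙-Iˡ {suc n} (suc i) (b ∷ᵥ 0ᵥ))
      reduce : x ∷ᵥ b ∷ᵥ 0ᵥ ⟿ x ∷ᵥ ρ ∷ᵥ 0ᵥ {n}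
      reduce = ⟿-trans (⟿-bordered {s = 1ℤ} x (b ∷ᵥ 0ᵥ) ((- q) ∷ᵥ 0ᵥ) refl inverses-I)
        (⟿-pointwise {w = x ∷ᵥ ρ ∷ᵥ 0ᵥ} λ { zero → *-identityˡ x ; (suc i) → reduced i })
      swapped : ∀ i → (x ∷ᵥ ρ ∷ᵥ 0ᵥ {n}) (σ i) ≡ (ρ ∷ᵥ x ∷ᵥ 0ᵥ) i
      swapped zero          = refl
      swapped (suc zero)    = refl
      swapped (suc (suc i)) = refl

    normalise-sign : ∀ z → ∃[ s ] s * s ≡ 1ℤ × s * z ≡ ℤ.+ ∣ z ∣
    normalise-sign (ℤ.+ n)      = 1ℤ , refl , *-identityˡ (ℤ.+ n)
    normalise-sign z@(ℤ.-[1+ n ]) = -1ℤ , refl , -1*i≡-i z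

    ⟿-axis : ∀ {n} (v : Vector (suc n)) → ∃[ a ] v ⟿ a ∷ᵥ 0ᵥ
    ⟿-axis {zero}  v = v zero , ⟿-pointwise λ { zero → refl }
    ⟿-axis {suc n} v
      with b , via {W} inv e ← ⟿-axis (v ∘ suc)
      with a , r ← euclid (suc ∣ v zero ∣) (v zero) b (ℕ.n<1+n ∣ v zero ∣) =
      a , ⟿-trans (⟿-pointwise λ { zero → refl ; (suc i) → refl })
        (⟿-trans (⟿-bordered {s = 1ℤ} (v zero) (v ∘ suc) 0ᵥ refl inv)
          (⟿-trans (⟿-pointwise λ where
            zero          → *-identityˡ (v zero)
            (suc zero)    → trans (+-identityˡ ((W ⋆ (v ∘ suc)) zero)) (e zero)
            (suc (suc i)) → trans (+-identityˡ ((W ⋆ (v ∘ suc)) (suc i))) (e (suc i))) r))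

    ⟿-axis⁺ : ∀ {n} (v : Vector (suc n)) → ∃[ a ] v ⟿ (ℤ.+ a) ∷ᵥ 0ᵥ
    ⟿-axis⁺ {n} v with a , r ← ⟿-axis v with s , s² , e ← normalise-sign a =
      ∣ a ∣ , ⟿-trans r (⟿-trans (⟿-pointwise λ { zero → refl ; (suc i) → refl })
        (⟿-trans (⟿-bordered {s = s} a 0ᵥ 0ᵥ s² inverses-I)
          (⟿-pointwise λ { zero → e ; (suc i) → trans (+-identityˡ ((I {n} ⋆ 0ᵥ) i)) (∙-Iˡ {n} i 0ᵥ) })))

  -- Equivalently, t is scale times the first row of the invertible matrix V.
  record PrimitiveRow {m} (t : Vector (suc m)) : Set where
    field
      scale : ℕ
      {U V} : Matrix (suc m) (suc m)
      inverses : Inverses U V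
      axis : ∀ j → (t ⊛ U) j ≡ ((ℤ.+ scale) ∷ᵥ 0ᵥ) j

  abstract
    primitive-row : ∀ {m} (t : Vector (suc m)) → PrimitiveRow t
    primitive-row {m} t = build (proj₁ r) (proj₂ r)
      where
      r : ∃[ a ] t ⟿ (ℤ.+ a) ∷ᵥ 0ᵥ
      r = ⟿-axis⁺ t
      build : ∀ a → t ⟿ (ℤ.+ a) ∷ᵥ 0ᵥ → PrimitiveRow t
      build a (via {W} inv e) = record
        { scale = a ; inverses = inverses-ᵀ inv ; axis = λ j → trans (∙-comm t (W j)) (e j) }

  axis-⊛ : ∀ {m n} a (M : Matrix (suc m) n) j → ((a ∷ᵥ 0ᵥ) ⊛ M) j ≡ a * M zero j
  axis-⊛ a M j = trans (cong (a * M zero j +_) (∙-zeroˡ {v = 0ᵥ} (λ _ → refl) (λ l → M (suc l) j)))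
    (+-identityʳ (a * M zero j))

  module _ {m} {t : Vector (suc m)} (P : PrimitiveRow t) where
    open PrimitiveRow P

    -- When `scale` is nonzero, a relation `t` among the rows of `M` thus becomes a vanishing first
    -- row after the invertible row operation `V`.
    primitive-row-⊛ : ∀ {n} (M : Matrix (suc m) n) j → (t ⊛ M) j ≡ ℤ.+ scale * (V ⊗ M) zero j
    primitive-row-⊛ M j = begin
      (t ⊛ M) j                             ≡⟨ sum-cong (λ l → cong (t l *_) (at (cancel-inverse (inverses-sym inverses) M) l j)) ⟨
      (t ⊛ (U ⊗ (V ⊗ M))) j                 ≡⟨ ⊛-assoc t U (V ⊗ M) j ⟨
      ((t ⊛ U) ⊛ (V ⊗ M)) j                 ≡⟨ ⊛-cong {M = V ⊗ M} axis j ⟩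
      (((ℤ.+ scale) ∷ᵥ 0ᵥ) ⊛ (V ⊗ M)) j     ≡⟨ axis-⊛ (ℤ.+ scale) (V ⊗ M) j ⟩
      ℤ.+ scale * (V ⊗ M) zero j ∎

    primitive-row-zero : scale ≡ 0 → ∀ i → t i ≡ 0ℤ
    primitive-row-zero s≡0 i = begin
      t i                              ≡⟨ ⊛-identityʳ t i ⟨
      (t ⊛ I) i                        ≡⟨ primitive-row-⊛ I i ⟩
      ℤ.+ scale * (V ⊗ I) zero i       ≡⟨ cong (λ s → ℤ.+ s * (V ⊗ I) zero i) s≡0 ⟩
      0ℤ * (V ⊗ I) zero i              ≡⟨ *-zeroˡ ((V ⊗ I) zero i) ⟩
      0ℤ ∎

  -- Integer relations between rows

  nonzero-factorʳ : ∀ {a z} → a ≢ 0 → ℤ.+ a * z ≡ 0ℤ → z ≡ 0ℤ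
  nonzero-factorʳ {a} a≢0 e with i*j≡0⇒i≡0∨j≡0 (ℤ.+ a) e
  ... | inj₁ p = contradiction (+-injective p) a≢0
  ... | inj₂ p = p

  -- Argued without leaving ℤ: a nonzero relation `t` yields an invertible `V` for which the first
  -- row of `V ⊗ Y` vanishes; hence `det (V ⊗ Y) ≡ 0`, and `∣ det V ∣ ≡ 1` gives `det Y ≡ 0`.
  left-kernel-trivial : ∀ {n} (Y : Matrix n n) → det Y ≢ 0ℤ → ∀ t → (∀ j → (t ⊛ Y) j ≡ 0ℤ) → ∀ i → t i ≡ 0ℤ
  left-kernel-trivial {suc n} Y d≢0 t tY≡0 = by-scale (scale ℕ.≟ 0)
    where
    P : PrimitiveRow t
    P = primitive-row t
    open PrimitiveRow P
    module _ (s≢0 : scale ≢ 0) where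
      row₀ : ∀ j → (V ⊗ Y) zero j ≡ 0ℤ
      row₀ j = nonzero-factorʳ s≢0 (trans (sym (primitive-row-⊛ P Y j)) (tY≡0 j))
      det-VY : det (V ⊗ Y) ≡ 0ℤ
      det-VY = trans (det-first-row (V ⊗ Y) (row₀ ∘ suc))
        (cong (_* det (λ i j → (V ⊗ Y) (suc i) (suc j))) (row₀ zero))
      det≡0 : det Y ≡ 0ℤ
      det≡0 = ∣i∣≡0⇒i≡0 (begin
        ∣ det Y ∣                  ≡⟨ ℕ.*-identityˡ ∣ det Y ∣ ⟨
        1 ℕ.* ∣ det Y ∣            ≡⟨ cong (ℕ._* ∣ det Y ∣) (det-invertible (inverses-sym inverses)) ⟨
        ∣ det V ∣ ℕ.* ∣ det Y ∣    ≡⟨ abs-det-⊗ V Y ⟨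
        ∣ det (V ⊗ Y) ∣            ≡⟨ cong ∣_∣ det-VY ⟩
        0 ∎)
    by-scale : Dec (scale ≡ 0) → ∀ i → t i ≡ 0ℤ
    by-scale (yes s≡0) = primitive-row-zero P s≡0
    by-scale (no s≢0)  = contradiction (det≡0 s≢0) d≢0

  record LeftKernel {m n} (M : Matrix m n) : Set where
    field
      vector  : Vector m
      nonzero : ¬ (∀ i → vector i ≡ 0ℤ)
      kills   : ∀ j → (vector ⊛ M) j ≡ 0ℤ

  abstract
    -- Row operations `W` clear the first column below its top entry. A relation among the lower
    -- rows of the remaining block, extended by 0 on the top row, is a relation for `W ⊗ M`;
    -- multiplying it by `W` gives one for `M`, nonzero because `W` is invertible.
    left-kernel-nontrivial : ∀ {n} (M : Matrix (suc n) n) → LeftKernel M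
    left-kernel-nontrivial {zero} M = record
      { vector = λ _ → 1ℤ ; nonzero = λ z → contradiction (z zero) λ () ; kills = λ () }
    left-kernel-nontrivial {suc n} M = build (proj₁ r) (proj₂ r)
      where
      r : ∃[ a ] (λ i → M i zero) ⟿ a ∷ᵥ 0ᵥ
      r = ⟿-axis (λ i → M i zero)
      build : ∀ a → (λ i → M i zero) ⟿ a ∷ᵥ 0ᵥ → LeftKernel M
      build a (via {W} {V} inv e) = record
        { vector = pad t ⊛ W
        ; nonzero = λ z → nonzero λ i →
            trans (sym (recover (suc i))) (∙-zeroˡ z (λ l → V l (suc i)))
        ; kills = λ where
            zero    → trans (⊛-assoc (pad t) W M zero)
              (trans (+-identityˡ (t ∙ (λ l → (W ⊗ M) (suc l) zero))) (∙-zeroʳ t (e ∘ suc)))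
            (suc j) → trans (⊛-assoc (pad t) W M (suc j))
              (trans (+-identityˡ (t ∙ (λ l → (W ⊗ M) (suc l) (suc j)))) (kills j)) }
        where
        open LeftKernel (left-kernel-nontrivial (λ i j → (W ⊗ M) (suc i) (suc j))) renaming (vector to t)
        recover : ∀ i → ((pad t ⊛ W) ⊛ V) i ≡ pad t i
        recover i = trans (⊛-assoc (pad t) W V i)
          (trans (sum-cong λ l → cong (pad t l *_) (at (invʳ inv) l i)) (⊛-identityʳ (pad t) i))

  record FirstRowAxis {k} (X : Matrix (suc k) (suc k)) : Set where
    field
      {mat inv} : Matrix (suc k) (suc k)
      inverses  : Inverses mat inv
      corner    : ℕ
      axis      : ∀ j → (mat ⊗ X) zero j ≡ ((ℤ.+ corner) ∷ᵥ 0ᵥ) j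

  abstract
    -- Let `t` be a nontrivial relation among the rows of `X` without its first column. The
    -- primitive vector in the direction of `t` is the first row of an invertible `V`, so the first
    -- row of `V ⊗ X` lies on the axis; a sign change of that row makes the corner nonnegative.
    first-row-axis : ∀ {k} (X : Matrix (suc k) (suc k)) → FirstRowAxis X
    first-row-axis {k} X = build (normalise-sign ((V ⊗ X) zero zero))
      where
      open LeftKernel (left-kernel-nontrivial (tails X)) renaming (vector to t)
      P : PrimitiveRow t
      P = primitive-row t
      open PrimitiveRow P
      row₀-tail : ∀ j → (V ⊗ X) zero (suc j) ≡ 0ℤ
      row₀-tail j = nonzero-factorʳ (nonzero ∘ primitive-row-zero P)
        (trans (sym (primitive-row-⊛ P X (suc j))) (kills j))
      build : (∃[ s ] s * s ≡ 1ℤ × s * (V ⊗ X) zero zero ≡ ℤ.+ ∣ (V ⊗ X) zero zero ∣) → FirstRowAxis X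
      build (s , s² , e) = record
        { inverses = inverses-⊗ {W = bordered s 0ᵥ I} (inverses-bordered {s = s} 0ᵥ s² inverses-I) (inverses-sym inverses)
        ; corner = ∣ (V ⊗ X) zero zero ∣
        ; axis = λ where
            zero    → trans (row₀ zero) e
            (suc j) → trans (row₀ (suc j)) (trans (cong (s *_) (row₀-tail j)) (*-zeroʳ s)) }
        where
        row₀ : ∀ j → ((bordered s 0ᵥ I ⊗ V) ⊗ X) zero j ≡ s * (V ⊗ X) zero j
        row₀ j = trans (at (⊗-assoc (bordered s 0ᵥ I) V X) zero j)
          (trans (cong (s * (V ⊗ X) zero j +_) (∙-zeroˡ {v = 0ᵥ} (λ _ → refl) (λ l → (V ⊗ X) (suc l) j)))
            (+-identityʳ (s * (V ⊗ X) zero j)))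

-- Local factors as complete homogeneous polynomials

module Factorisations where
  open import Data.Nat
  open import Data.Nat.Properties
  open import Data.Nat.Divisibility
  open import Data.Nat.Primality using (Prime; euclidsLemma; prime⇒nonZero; prime⇒nonTrivial; prime⇒irreducible)
  open import Data.Nat.ListAction using (sum)
  open import Data.Nat.ListAction.Properties using (sum-++)
  open import Data.Nat.Tactic.RingSolver using (solve-∀)
  open import Data.Fin as Fin using (Fin; zero; suc; toℕ; inject₁)
  import Data.Fin.Properties as Fin
  open import Data.Fin.Properties using (toℕ-inject₁; toℕ<n; toℕ-injective; +↔⊎)
  open import Data.List using (List; []; _∷_; _++_; map; concatMap; applyUpTo; upTo)
  open import Data.List.Properties using (map-++; map-applyUpTo)
  open import Data.List.Relation.Unary.All as All using (All; []; _∷_)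
  import Data.List.Relation.Unary.All.Properties as All
  open import Data.Vec using (Vec; []; _∷_; tabulate)
  open import Data.Product using (Σ; _×_; _,_; ∃-syntax; proj₁; proj₂)
  open import Data.Sum using (_⊎_; inj₁; inj₂; [_,_]′)
  open import Data.Sum.Function.Propositional using (_⊎-↔_)
  open import Data.Unit using (⊤; tt)
  open import Function using (_∘_; _↔_; mk↔ₛ′)
  open import Function.Construct.Composition using (_↔-∘_)
  open import Function.Construct.Symmetry using (↔-sym)
  open import Relation.Nullary using (¬_; contradiction)
  open import Relation.Binary.PropositionalEquality
  open ≡-Reasoning

  ^-distribʳ-* : ∀ k m n → (m * n) ^ k ≡ m ^ k * n ^ k
  ^-distribʳ-* zero    m n = refl
  ^-distribʳ-* (suc k) m n = trans (cong (m * n *_) (^-distribʳ-* k m n)) ([m*n]*[o*p]≡[m*o]*[n*p] m n (m ^ k) (n ^ k))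

  -- The complete homogeneous symmetric polynomial of degree e in 1, p, …, p^(k-1).
  homogeneous : ℕ → ℕ → ℕ → ℕ
  homogeneous p k       zero    = 1
  homogeneous p zero    (suc e) = 0
  homogeneous p (suc k) (suc e) = homogeneous p k (suc e) + p ^ k * homogeneous p (suc k) e

  range-step : ∀ lo s k → lo + suc s ≡ suc k → range lo k ≡ lo ∷ range (suc lo) k
  range-step lo s k eq = begin
    range lo k                                    ≡⟨ cong (map (lo +_) ∘ upTo) (trans (cong (_∸ lo) (sym eq)) (m+n∸m≡n lo (suc s))) ⟩
    lo + 0 ∷ map (lo +_) (applyUpTo suc s)        ≡⟨ cong₂ _∷_ (+-identityʳ lo) (map-applyUpTo suc (lo +_) s) ⟩
    lo ∷ applyUpTo (λ i → lo + suc i) s           ≡⟨ cong (lo ∷_) (applyUpTo-cong s (+-suc lo)) ⟩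
    lo ∷ applyUpTo (λ i → suc lo + i) s           ≡⟨ cong (lo ∷_) (map-applyUpTo (λ i → i) (suc lo +_) s) ⟨
    lo ∷ map (suc lo +_) (upTo s)
      ≡⟨ cong (λ n → lo ∷ map (suc lo +_) (upTo n)) (trans (cong (_∸ suc lo) (trans (sym eq) (+-suc lo s))) (m+n∸m≡n (suc lo) s)) ⟨
    lo ∷ range (suc lo) k ∎
    where
    applyUpTo-cong : ∀ {f g : ℕ → ℕ} n → (∀ i → f i ≡ g i) → applyUpTo f n ≡ applyUpTo g n
    applyUpTo-cong zero    e = refl
    applyUpTo-cong (suc n) e = cong₂ _∷_ (e 0) (applyUpTo-cong n (e ∘ suc))

  range-empty : ∀ k → range (suc k) k ≡ []
  range-empty k = cong (λ m → map (suc k +_) (upTo m)) (n∸n≡0 k)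

  -- A nondecreasing sequence either starts with `lo`, which then remains the lower bound, or avoids
  -- `lo` altogether. These are the two terms in the recursion of `homogeneous`.
  nondecSeqs-step : ∀ lo s k e → lo + suc s ≡ suc k →
    nondecSeqs lo k (suc e) ≡ map (lo ∷_) (nondecSeqs lo k e) ++ nondecSeqs (suc lo) k (suc e)
  nondecSeqs-step lo s k e eq = cong (concatMap (λ j → map (j ∷_) (nondecSeqs j k e))) (range-step lo s k eq)

  nondecSeqs-empty : ∀ k e → nondecSeqs (suc k) k (suc e) ≡ []
  nondecSeqs-empty k e = cong (concatMap (λ j → map (j ∷_) (nondecSeqs j k e))) (range-empty k)

  lo≤k : ∀ {lo s k} → lo + suc s ≡ suc k → lo ≤ k
  lo≤k {lo} {s} eq = s≤s⁻¹ (≤-trans (m≤m+n (suc lo) s) (≤-reflexive (trans (sym (+-suc lo s)) eq)))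

  -- Guarantees that the truncated subtraction in the exponents of the local factor never truncates.
  nondecSeqs-sum≤ : ∀ s lo k e → lo + s ≡ suc k → All (λ js → sum js ≤ e * k) (nondecSeqs lo k e)
  nondecSeqs-sum≤ s lo k zero eq = z≤n ∷ []
  nondecSeqs-sum≤ zero lo k (suc e) eq rewrite trans (sym (+-identityʳ lo)) eq | nondecSeqs-empty k e = []
  nondecSeqs-sum≤ (suc s) lo k (suc e) eq rewrite nondecSeqs-step lo s k e eq =
    All.++⁺ (All.map⁺ (All.map (+-mono-≤ (lo≤k eq)) (nondecSeqs-sum≤ (suc s) lo k e eq)))
      (nondecSeqs-sum≤ s (suc lo) k (suc e) (trans (sym (+-suc lo s)) eq))

  ∸-+-interchange : ∀ {a b c d} → b ≤ a → d ≤ c → (a + c) ∸ (b + d) ≡ (a ∸ b) + (c ∸ d)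
  ∸-+-interchange {a} {b} {c} {d} b≤a d≤c = begin
    (a + c) ∸ (b + d)    ≡⟨ ∸-+-assoc (a + c) b d ⟨
    (a + c) ∸ b ∸ d      ≡⟨ cong (_∸ d) (+-∸-comm c b≤a) ⟩
    (a ∸ b) + c ∸ d      ≡⟨ +-∸-assoc (a ∸ b) d≤c ⟩
    (a ∸ b) + (c ∸ d) ∎

  module _ (p k : ℕ) where

    weight : ℕ → List ℕ → ℕ
    weight e js = p ^ (e * k ∸ sum js)

    sum-prepend : ∀ {lo} e Js → lo ≤ k → All (λ js → sum js ≤ e * k) Js →
      sum (map (weight (suc e)) (map (lo ∷_) Js)) ≡ p ^ (k ∸ lo) * sum (map (weight e) Js)
    sum-prepend {lo} e []  lo≤k []       = sym (*-zeroʳ (p ^ (k ∸ lo)))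
    sum-prepend {lo} e (js ∷ Js) lo≤k (b ∷ bs) = begin
      p ^ (k + e * k ∸ (lo + sum js)) + _    ≡⟨ cong₂ _+_ (trans (cong (p ^_) (∸-+-interchange lo≤k b)) (^-distribˡ-+-* p (k ∸ lo) (e * k ∸ sum js))) (sum-prepend e Js lo≤k bs) ⟩
      p ^ (k ∸ lo) * weight e js + p ^ (k ∸ lo) * sum (map (weight e) Js)  ≡⟨ *-distribˡ-+ (p ^ (k ∸ lo)) (weight e js) _ ⟨
      p ^ (k ∸ lo) * (weight e js + sum (map (weight e) Js)) ∎

    -- The exponent `e * k ∸ sum js` is the sum of the `k ∸ j`, so a sequence is a monomial in the
    -- variables `p ^ (k ∸ j)`. For j from `lo` to `k` these are the `s` variables 1, p, ...,
    -- p^(s-1).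
    sum-nondecSeqs : ∀ s lo e → lo + s ≡ suc k → sum (map (weight e) (nondecSeqs lo k e)) ≡ homogeneous p s e
    sum-nondecSeqs s       lo zero    eq = refl
    sum-nondecSeqs zero    lo (suc e) eq rewrite trans (sym (+-identityʳ lo)) eq | nondecSeqs-empty k e = refl
    sum-nondecSeqs (suc s) lo (suc e) eq = begin
      sum (map w (nondecSeqs lo k (suc e)))                        ≡⟨ cong (sum ∘ map w) (nondecSeqs-step lo s k e eq) ⟩
      sum (map w (map (lo ∷_) Js ++ Js′))                          ≡⟨ cong sum (map-++ w (map (lo ∷_) Js) Js′) ⟩
      sum (map w (map (lo ∷_) Js) ++ map w Js′)                    ≡⟨ sum-++ (map w (map (lo ∷_) Js)) (map w Js′) ⟩
      sum (map w (map (lo ∷_) Js)) + sum (map w Js′)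
        ≡⟨ cong₂ _+_ (sum-prepend e Js (lo≤k eq) (nondecSeqs-sum≤ (suc s) lo k e eq)) (sum-nondecSeqs s (suc lo) (suc e) eq′) ⟩
      p ^ (k ∸ lo) * sum (map (weight e) Js) + homogeneous p s (suc e)
        ≡⟨ cong₂ (λ n x → p ^ n * x + homogeneous p s (suc e)) (trans (cong (_∸ lo) (sym (suc-injective eq′))) (m+n∸m≡n lo s)) (sum-nondecSeqs (suc s) lo e eq) ⟩
      p ^ s * homogeneous p (suc s) e + homogeneous p s (suc e)    ≡⟨ +-comm (p ^ s * homogeneous p (suc s) e) _ ⟩
      homogeneous p (suc s) (suc e) ∎
      where
      w : List ℕ → ℕ
      w = weight (suc e)
      Js Js′ : List (List ℕ)
      Js  = nondecSeqs lo k e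
      Js′ = nondecSeqs (suc lo) k (suc e)
      eq′ : suc lo + s ≡ suc k
      eq′ = trans (sym (+-suc lo s)) eq

  localFactor≡homogeneous : ∀ p e k → localFactor p e k ≡ homogeneous p k e
  localFactor≡homogeneous p e k = sum-nondecSeqs p k k 1 e refl

  sumℕ : ∀ {n} → (Fin n → ℕ) → ℕ
  sumℕ {zero}  f = 0
  sumℕ {suc n} f = f zero + sumℕ (f ∘ suc)

  sumℕ-cong : ∀ {n} {f g : Fin n → ℕ} → (∀ i → f i ≡ g i) → sumℕ f ≡ sumℕ g
  sumℕ-cong {zero}  e = refl
  sumℕ-cong {suc n} e = cong₂ _+_ (e zero) (sumℕ-cong (e ∘ suc))

  sumℕ-*ˡ : ∀ {n} c (f : Fin n → ℕ) → sumℕ (λ i → c * f i) ≡ c * sumℕ f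
  sumℕ-*ˡ {zero}  c f = sym (*-zeroʳ c)
  sumℕ-*ˡ {suc n} c f = trans (cong (c * f zero +_) (sumℕ-*ˡ c (f ∘ suc))) (sym (*-distribˡ-+ c (f zero) _))

  Σ-Fin↔ : ∀ {n} {T : Fin n → Set} {f : Fin n → ℕ} → (∀ i → T i ↔ Fin (f i)) → Σ (Fin n) T ↔ Fin (sumℕ f)
  Σ-Fin↔ {zero}  bij = mk↔ₛ′ (λ ()) (λ ()) (λ ()) (λ ())
  Σ-Fin↔ {suc n} {T} {f} bij = ↔-sym +↔⊎ ↔-∘ ((bij zero ⊎-↔ Σ-Fin↔ (bij ∘ suc)) ↔-∘ first-or-rest)
    where
    first-or-rest : Σ (Fin (suc n)) T ↔ (T zero ⊎ Σ (Fin n) (T ∘ suc))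
    first-or-rest = mk↔ₛ′
      (λ { (zero , x) → inj₁ x ; (suc i , x) → inj₂ (i , x) })
      [ (zero ,_) , (λ { (i , x) → suc i , x }) ]′
      (λ { (inj₁ x) → refl ; (inj₂ _) → refl })
      (λ { (zero , x) → refl ; (suc i , x) → refl })

  -- Monomials are sorted by the exponent `a` of the last variable `p ^ k`. Its contribution
  -- `(p ^ a) ^ k` is at the same time the weight g^k of the divisor g = p^a.
  homogeneous-splits : ∀ p k e →
    sumℕ {suc e} (λ a → (p ^ toℕ a) ^ k * homogeneous p k (e ∸ toℕ a)) ≡ homogeneous p (suc k) e
  homogeneous-splits p k zero = begin
    1 ^ k * 1 + 0   ≡⟨ +-identityʳ (1 ^ k * 1) ⟩
    1 ^ k * 1       ≡⟨ *-identityʳ (1 ^ k) ⟩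
    1 ^ k           ≡⟨ ^-zeroˡ k ⟩
    1 ∎
  homogeneous-splits p k (suc e) = begin
    1 ^ k * homogeneous p k (suc e) + sumℕ {suc e} (λ a → (p * p ^ toℕ a) ^ k * homogeneous p k (e ∸ toℕ a))
      ≡⟨ cong₂ _+_ (trans (cong (_* homogeneous p k (suc e)) (^-zeroˡ k)) (*-identityˡ _))
           (trans (sumℕ-cong {suc e} λ a → trans (cong (_* homogeneous p k (e ∸ toℕ a)) (^-distribʳ-* k p (p ^ toℕ a))) (*-assoc (p ^ k) _ _))
             (sumℕ-*ˡ {suc e} (p ^ k) (λ a → (p ^ toℕ a) ^ k * homogeneous p k (e ∸ toℕ a)))) ⟩
    homogeneous p k (suc e) + p ^ k * sumℕ {suc e} (λ a → (p ^ toℕ a) ^ k * homogeneous p k (e ∸ toℕ a))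
      ≡⟨ cong (λ x → homogeneous p k (suc e) + p ^ k * x) (homogeneous-splits p k e) ⟩
    homogeneous p (suc k) (suc e) ∎

  -- Exponent vectors and divisors

  value : ∀ {l} → (Fin l → ℕ) → Vec ℕ l → ℕ
  value p []       = 1
  value p (e ∷ es) = p zero ^ e * value (p ∘ suc) es

  -- The number of subgroups of index ∏ pᵢ^eᵢ in ℤ^k.
  subgroups : ∀ {l} → (Fin l → ℕ) → ℕ → Vec ℕ l → ℕ
  subgroups p k []       = 1
  subgroups p k (e ∷ es) = homogeneous (p zero) k e * subgroups (p ∘ suc) k es

  -- Stands for a factorisation of `value p es` into two factors: for each prime, how much of its
  -- exponent goes to the first factor. The type is finite by construction and a product over the
  -- primes.
  Split : ∀ {l} → Vec ℕ l → Set
  Split []       = ⊤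
  Split (e ∷ es) = Fin (suc e) × Split es

  left right : ∀ {l} (es : Vec ℕ l) → Split es → Vec ℕ l
  left []       _       = []
  left (e ∷ es) (a , s) = toℕ a ∷ left es s
  right []       _       = []
  right (e ∷ es) (a , s) = (e ∸ toℕ a) ∷ right es s

  sumSplits : ∀ {l} (es : Vec ℕ l) → (Split es → ℕ) → ℕ
  sumSplits []       F = F tt
  sumSplits (e ∷ es) F = sumℕ {suc e} (λ a → sumSplits es (λ s → F (a , s)))

  Σ-Split↔ : ∀ {l} (es : Vec ℕ l) {F : Split es → ℕ} → Σ (Split es) (Fin ∘ F) ↔ Fin (sumSplits es F)
  Σ-Split↔ []       = mk↔ₛ′ proj₂ (tt ,_) (λ _ → refl) (λ _ → refl)
  Σ-Split↔ (e ∷ es) {F} = Σ-Fin↔ {T = λ a → Σ (Split es) (λ s → Fin (F (a , s)))} (λ a → Σ-Split↔ es) ↔-∘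
    mk↔ₛ′ (λ { ((a , s) , x) → a , s , x }) (λ { (a , s , x) → (a , s) , x }) (λ _ → refl) (λ _ → refl)

  sumSplits-cong : ∀ {l} (es : Vec ℕ l) {F G : Split es → ℕ} → (∀ s → F s ≡ G s) → sumSplits es F ≡ sumSplits es G
  sumSplits-cong []       e = e tt
  sumSplits-cong (_ ∷ es) e = sumℕ-cong λ a → sumSplits-cong es λ s → e (a , s)

  sumSplits-*ˡ : ∀ {l} (es : Vec ℕ l) c (F : Split es → ℕ) → sumSplits es (λ s → c * F s) ≡ c * sumSplits es F
  sumSplits-*ˡ []       c F = refl
  sumSplits-*ˡ (e ∷ es) c F = trans (sumℕ-cong {suc e} λ a → sumSplits-*ˡ es c (λ s → F (a , s))) (sumℕ-*ˡ {suc e} c (λ a → sumSplits es (λ s → F (a , s))))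

  -- A Dirichlet convolution of multiplicative functions: the sum over splittings factors over the
  -- primes, and each factor is `homogeneous-splits`.
  subgroups-splits : ∀ {l} (p : Fin l → ℕ) k es →
    sumSplits es (λ s → value p (left es s) ^ k * subgroups p k (right es s)) ≡ subgroups p (suc k) es
  subgroups-splits p k []       = trans (*-identityʳ (1 ^ k)) (^-zeroˡ k)
  subgroups-splits p k (e ∷ es) = begin
    sumℕ {suc e} (λ a → sumSplits es (λ s → (p₀ ^ toℕ a * v s) ^ k * (h a * c s)))
      ≡⟨ sumℕ-cong {suc e} (λ a → trans (sumSplits-cong es λ s → regroup (p₀ ^ toℕ a) (v s) (h a) (c s))
           (sumSplits-*ˡ es ((p₀ ^ toℕ a) ^ k * h a) (λ s → v s ^ k * c s))) ⟩
    sumℕ {suc e} (λ a → (p₀ ^ toℕ a) ^ k * h a * sumSplits es (λ s → v s ^ k * c s))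
      ≡⟨ sumℕ-cong {suc e} (λ a → trans (cong ((p₀ ^ toℕ a) ^ k * h a *_) (subgroups-splits (p ∘ suc) k es)) (*-comm ((p₀ ^ toℕ a) ^ k * h a) C)) ⟩
    sumℕ {suc e} (λ a → C * ((p₀ ^ toℕ a) ^ k * h a))       ≡⟨ sumℕ-*ˡ {suc e} C (λ a → (p₀ ^ toℕ a) ^ k * h a) ⟩
    C * sumℕ {suc e} (λ a → (p₀ ^ toℕ a) ^ k * h a)         ≡⟨ cong (C *_) (homogeneous-splits p₀ k e) ⟩
    C * homogeneous p₀ (suc k) e                            ≡⟨ *-comm C _ ⟩
    subgroups p (suc k) (e ∷ es) ∎
    where
    p₀ C : ℕ
    p₀ = p zero
    C  = subgroups (p ∘ suc) (suc k) es
    v c : Split es → ℕ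
    v s = value (p ∘ suc) (left es s)
    c s = subgroups (p ∘ suc) k (right es s)
    h : Fin (suc e) → ℕ
    h a = homogeneous p₀ k (e ∸ toℕ a)
    regroup : ∀ x y z w → (x * y) ^ k * (z * w) ≡ x ^ k * z * (y ^ k * w)
    regroup x y z w = trans (cong (_* (z * w)) (^-distribʳ-* k x y)) ([m*n]*[o*p]≡[m*o]*[n*p] (x ^ k) (y ^ k) z w)

  -- The start of the recursion in `k`: the empty matrix has determinant 1, so there is one class
  -- for the value 1 and none for any other. A positive exponent excludes the value 1 because a
  -- prime is not 1.
  subgroups-zero : ∀ {l} (p : Fin l → ℕ) → (∀ i → Prime (p i)) → ∀ es →
    (value p es ≡ 1 × subgroups p 0 es ≡ 1) ⊎ (value p es ≢ 1 × subgroups p 0 es ≡ 0)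
  subgroups-zero p pr []             = inj₁ (refl , refl)
  subgroups-zero p pr (zero ∷ es)    with subgroups-zero (p ∘ suc) (pr ∘ suc) es
  ... | inj₁ (v , c) = inj₁ (trans (+-identityʳ _) v , trans (+-identityʳ _) c)
  ... | inj₂ (v , c) = inj₂ (v ∘ trans (sym (+-identityʳ _)) , trans (+-identityʳ _) c)
  subgroups-zero p pr (suc e ∷ es)   = inj₂ (not-one , refl)
    where
    not-one : p zero ^ suc e * value (p ∘ suc) es ≢ 1
    not-one eq = contradiction (m*n≡1⇒m≡1 (p zero) (p zero ^ e) (m*n≡1⇒m≡1 (p zero ^ suc e) _ eq))
      (nonTrivial⇒≢1 {{prime⇒nonTrivial (pr zero)}})

  value-split : ∀ {l} (p : Fin l → ℕ) es s → value p (left es s) * value p (right es s) ≡ value p es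
  value-split p []       _       = refl
  value-split p (e ∷ es) (a , s) = begin
    p₀ ^ toℕ a * v * (p₀ ^ (e ∸ toℕ a) * w)    ≡⟨ [m*n]*[o*p]≡[m*o]*[n*p] (p₀ ^ toℕ a) v (p₀ ^ (e ∸ toℕ a)) w ⟩
    p₀ ^ toℕ a * p₀ ^ (e ∸ toℕ a) * (v * w)    ≡⟨ cong₂ _*_ (sym (^-distribˡ-+-* p₀ (toℕ a) (e ∸ toℕ a))) (value-split (p ∘ suc) es s) ⟩
    p₀ ^ (toℕ a + (e ∸ toℕ a)) * value (p ∘ suc) es  ≡⟨ cong (λ n → p₀ ^ n * value (p ∘ suc) es) (m+[n∸m]≡n (s≤s⁻¹ (toℕ<n a))) ⟩
    p₀ ^ e * value (p ∘ suc) es ∎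
    where
    p₀ v w : ℕ
    p₀ = p zero
    v = value (p ∘ suc) (left es s)
    w = value (p ∘ suc) (right es s)

  -- The `e` copies of `p` are handed out one at a time by Euclid's lemma. Since `m` may contain
  -- further factors `p`, only existence is asserted.
  prime-power-factor : ∀ {p} → Prime p → ∀ e g g′ m → g * g′ ≡ p ^ e * m →
    ∃[ a ] ∃[ h ] ∃[ h′ ] g ≡ p ^ toℕ {suc e} a * h × g′ ≡ p ^ (e ∸ toℕ a) * h′ × h * h′ ≡ m
  prime-power-factor {p} pr zero g g′ m eq =
    zero , g , g′ , sym (+-identityʳ g) , sym (+-identityʳ g′) , trans eq (+-identityʳ m)
  prime-power-factor {p} pr (suc e) g g′ m eq =
    by-factor (euclidsLemma g g′ pr (divides (p ^ e * m) (trans eq (trans (*-assoc p (p ^ e) m) (*-comm p (p ^ e * m))))))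
    where
    instance
      p-nonZero : NonZero p
      p-nonZero = prime⇒nonZero pr
    rotateˡ : ∀ p q g → p * (q * g) ≡ q * p * g
    rotateˡ = solve-∀
    rotateʳ : ∀ p g q → p * (g * q) ≡ g * (q * p)
    rotateʳ = solve-∀
    absorb : ∀ x h p → x * h * p ≡ p * x * h
    absorb = solve-∀
    cancel : ∀ {x} → p * x ≡ g * g′ → x ≡ p ^ e * m
    cancel {x} q = *-cancelˡ-≡ x (p ^ e * m) p (trans q (trans eq (*-assoc p (p ^ e) m)))
    Factors : ℕ → ℕ → ℕ → Set
    Factors e g g′ = ∃[ a ] ∃[ h ] ∃[ h′ ] g ≡ p ^ toℕ {suc e} a * h × g′ ≡ p ^ (e ∸ toℕ a) * h′ × h * h′ ≡ m
    into-left : ∀ {q g g′} → g ≡ q * p → Factors e q g′ → Factors (suc e) g g′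
    into-left g≡qp (a , h , h′ , refl , e₂ , e₃) = suc a , h , h′ , trans g≡qp (absorb (p ^ toℕ a) h p) , e₂ , e₃
    into-right : ∀ {q g g′} → g′ ≡ q * p → Factors e g q → Factors (suc e) g g′
    into-right {g = g} {g′} g′≡qp (a , h , h′ , e₁ , refl , e₃) =
      inject₁ a , h , h′ , subst (λ n → g ≡ p ^ n * h) (sym (toℕ-inject₁ a)) e₁ ,
      subst (λ n → g′ ≡ p ^ n * h′)
        (trans (sym (+-∸-assoc 1 (s≤s⁻¹ (toℕ<n a)))) (cong (suc e ∸_) (sym (toℕ-inject₁ a))))
        (trans g′≡qp (absorb (p ^ (e ∸ toℕ a)) h′ p)) , e₃
    by-factor : p ∣ g ⊎ p ∣ g′ → Factors (suc e) g g′
    by-factor (inj₁ (divides q g≡qp)) = into-left g≡qp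
      (prime-power-factor pr e q g′ m (cancel (trans (rotateˡ p q g′) (cong (_* g′) (sym g≡qp)))))
    by-factor (inj₂ (divides q g′≡qp)) = into-right g′≡qp
      (prime-power-factor pr e g q m (cancel (trans (rotateʳ p g q) (cong (g *_) (sym g′≡qp)))))

  factor-split : ∀ {l} (p : Fin l → ℕ) → (∀ i → Prime (p i)) → ∀ es g g′ → g * g′ ≡ value p es →
    ∃[ s ] value p (left es s) ≡ g × value p (right es s) ≡ g′
  factor-split p pr []       g g′ eq = tt , sym (m*n≡1⇒m≡1 g g′ eq) , sym (m*n≡1⇒n≡1 g g′ eq)
  factor-split p pr (e ∷ es) g g′ eq
    with a , h , h′ , refl , refl , eq′ ← prime-power-factor (pr zero) e g g′ (value (p ∘ suc) es) eq
    with s , refl , refl ← factor-split (p ∘ suc) (pr ∘ suc) es h h′ eq′ = (a , s) , refl , refl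

  prime∣prime : ∀ {p q} → Prime p → Prime q → p ∣ q → p ≡ q
  prime∣prime pr qr d with prime⇒irreducible qr d
  ... | inj₁ p≡1 = contradiction p≡1 (nonTrivial⇒≢1 {{prime⇒nonTrivial pr}})
  ... | inj₂ p≡q = p≡q

  prime∣power : ∀ {p} → Prime p → ∀ m e → p ∣ m ^ e → p ∣ m
  prime∣power pr m zero    d = contradiction (∣1⇒≡1 d) (nonTrivial⇒≢1 {{prime⇒nonTrivial pr}})
  prime∣power pr m (suc e) d with euclidsLemma m (m ^ e) pr d
  ... | inj₁ d′ = d′
  ... | inj₂ d′ = prime∣power pr m e d′

  other-prime∤value : ∀ {l q} (p : Fin l → ℕ) → (∀ i → Prime (p i)) → Prime q → (∀ i → q ≢ p i) → ∀ es → ¬ q ∣ value p es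
  other-prime∤value p pr qr ne []       d = contradiction (∣1⇒≡1 d) (nonTrivial⇒≢1 {{prime⇒nonTrivial qr}})
  other-prime∤value p pr qr ne (e ∷ es) d with euclidsLemma (p zero ^ e) (value (p ∘ suc) es) qr d
  ... | inj₁ d′ = ne zero (prime∣prime qr (pr zero) (prime∣power qr (p zero) e d′))
  ... | inj₂ d′ = other-prime∤value (p ∘ suc) (pr ∘ suc) qr (ne ∘ suc) es d′

  prime-power-unique : ∀ {p} → Prime p → ∀ a b {g h} → ¬ p ∣ g → ¬ p ∣ h → p ^ a * g ≡ p ^ b * h → a ≡ b × g ≡ h
  prime-power-unique pr zero    zero    {g} {h} _ _ eq = refl , trans (sym (+-identityʳ g)) (trans eq (+-identityʳ h))
  prime-power-unique {p} pr zero (suc b) {g} {h} p∤g _ eq =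
    contradiction (divides (p ^ b * h) (trans (sym (+-identityʳ g)) (trans eq (trans (*-assoc p (p ^ b) h) (*-comm p _))))) p∤g
  prime-power-unique {p} pr (suc a) zero {g} {h} _ p∤h eq =
    contradiction (divides (p ^ a * g) (trans (sym (+-identityʳ h)) (trans (sym eq) (trans (*-assoc p (p ^ a) g) (*-comm p _))))) p∤h
  prime-power-unique {p} pr (suc a) (suc b) {g} {h} p∤g p∤h eq
    with refl , g≡h ← prime-power-unique pr a b p∤g p∤h (*-cancelˡ-≡ (p ^ a * g) (p ^ b * h) p {{prime⇒nonZero pr}}
      (trans (sym (*-assoc p (p ^ a) g)) (trans eq (*-assoc p (p ^ b) h)))) = refl , g≡h

  -- Because the primes are distinct, `p zero` does not divide the part belonging to the others, so
  -- its exponent can be read off.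
  split-unique : ∀ {l} (p : Fin l → ℕ) → (∀ i → Prime (p i)) → (∀ {i j} → p i ≡ p j → i ≡ j) → ∀ es s s′ →
    value p (left es s) ≡ value p (left es s′) → s ≡ s′
  split-unique p pr inj []       _       _         eq = refl
  split-unique p pr inj (e ∷ es) (a , s) (a′ , s′) eq =
    cong₂ _,_ (toℕ-injective (proj₁ parts))
      (split-unique (p ∘ suc) (pr ∘ suc) (λ q → Fin.suc-injective (inj q)) es s s′ (proj₂ parts))
    where
    coprime : ∀ s → ¬ p zero ∣ value (p ∘ suc) (left es s)
    coprime s = other-prime∤value (p ∘ suc) (pr ∘ suc) (pr zero) (λ i q → contradiction (inj q) λ ()) (left es s)
    parts : toℕ a ≡ toℕ a′ × value (p ∘ suc) (left es s) ≡ value (p ∘ suc) (left es s′)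
    parts = prime-power-unique (pr zero) (toℕ a) (toℕ a′) (coprime s) (coprime s′) eq

  value-nonzero : ∀ {l} (p : Fin l → ℕ) → (∀ i → Prime (p i)) → ∀ es → value p es ≢ 0
  value-nonzero p pr (e ∷ es) eq with m*n≡0⇒m≡0∨n≡0 (p zero ^ e) eq
  ... | inj₁ z = contradiction (m^n≡0⇒m≡0 (p zero) e z) (≢-nonZero⁻¹ (p zero) {{prime⇒nonZero (pr zero)}})
  ... | inj₂ z = value-nonzero (p ∘ suc) (pr ∘ suc) es z

  value-tabulate : ∀ {l} (p e : Fin l → ℕ) → value p (tabulate e) ≡ prodℕ (λ i → p i ^ e i)
  value-tabulate {zero}  p e = refl
  value-tabulate {suc l} p e = cong (p zero ^ e zero *_) (value-tabulate (p ∘ suc) (e ∘ suc))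

  subgroups-tabulate : ∀ {l} (p e : Fin l → ℕ) k → subgroups p k (tabulate e) ≡ prodℕ (λ i → localFactor (p i) (e i) k)
  subgroups-tabulate {zero}  p e k = refl
  subgroups-tabulate {suc l} p e k = cong₂ _*_ (sym (localFactor≡homogeneous (p zero) (e zero) k))
    (subgroups-tabulate (p ∘ suc) (e ∘ suc) k)

-- Systems of representatives and their transport

module Classes where
  open Matrices
  open Factorisations
    using (value; subgroups; subgroups-zero; subgroups-splits; value-split; value-nonzero;
           Split; left; right; Σ-Split↔; factor-split; split-unique; ^-distribʳ-*)
  open import Data.Nat as ℕ using (ℕ; zero; suc)
  import Data.Nat.Properties as ℕ
  open import Data.Nat.Divisibility as ℕ∣ using (divides) renaming (_∣_ to _∣ℕ_)
  open import Data.Nat.Primality using (Prime)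
  open import Data.Nat.Tactic.RingSolver using () renaming (solve-∀ to solve-∀ℕ)
  open import Data.Integer as ℤ using (ℤ; 0ℤ; 1ℤ; -1ℤ; _+_; _*_; -_; ∣_∣)
  open import Data.Integer.Properties
  open import Data.Integer.Divisibility.Signed using (_∣_; ∣ᵤ⇒∣; ∣⇒∣ᵤ)
  open import Data.Integer.DivMod using (a≡a%ℕn+[a/ℕn]*n; n%ℕd<d)
  open import Data.Integer.Tactic.RingSolver using (solve-∀)
  open import Data.Fin as Fin using (Fin; zero; suc; toℕ; splitAt; _↑ʳ_; fromℕ<; finToFun; funToFin)
  open import Data.Fin.Properties
    using (splitAt-↑ʳ; splitAt⁻¹-↑ʳ; toℕ<n; toℕ-injective; toℕ-fromℕ<; finToFun-funToFin; funToFin-finToFin; *↔×)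
  open import Data.Product using (Σ; _×_; _,_; ∃-syntax; proj₁; proj₂)
  open import Data.Sum using (_⊎_; inj₁; inj₂; [_,_]′; map₁)
  open import Function using (_∘_; _↔_; Inverse)
  open import Function.Construct.Composition using (_↔-∘_)
  open import Function.Construct.Identity using (↔-id)
  open import Function.Construct.Symmetry using (↔-sym)
  open import Relation.Nullary using (contradiction)
  open import Relation.Binary.PropositionalEquality
  open ≡-Reasoning

  record Covered {r k} (A : Matrix r (r ℕ.+ k)) {T : Set} (rep : T → Matrix k (r ℕ.+ k)) (X : Matrix k (r ℕ.+ k)) : Set where
    field
      index     : T
      {mat inv} : Matrix (r ℕ.+ k) (r ℕ.+ k)
      inverses  : Inverses mat inv
      equation  : stack A X ≈ mat ⊗ stack A (rep index)

  -- Distinct classes are kept apart even by non-unimodular W, while every solution is reached by an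
  -- explicitly invertible one; this way inverses of unimodular matrices are never needed.
  record Count {r k} (A : Matrix r (r ℕ.+ k)) (d : ℕ) (T : Set) : Set where
    field
      rep      : T → Matrix k (r ℕ.+ k)
      solves   : ∀ i → ∣ det (stack A (rep i)) ∣ ≡ d
      distinct : ∀ i j W → W ⊗ stack A (rep j) ≈ stack A (rep i) → i ≡ j
      covers   : ∀ X → ∣ det (stack A X) ∣ ≡ d → Covered A rep X

  count-reindex : ∀ {r k} {A : Matrix r (r ℕ.+ k)} {d T T′} → T′ ↔ T → Count A d T → Count A d T′
  count-reindex {A = A} {T′ = T′} bij C = record
    { rep = rep ∘ to
    ; solves = solves ∘ to
    ; distinct = λ i j W e → trans (sym (strictlyInverseʳ i)) (trans (cong from (distinct (to i) (to j) W e)) (strictlyInverseʳ j))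
    ; covers = λ X e → recover (covers X e) }
    where
    open Count C
    open Inverse bij
    recover : ∀ {X} → Covered A rep X → Covered A (rep ∘ to) X
    recover c = record
      { index = from index
      ; inverses = inverses
      ; equation = subst (λ t → stack A _ ≈ mat ⊗ stack A (rep t)) (sym (strictlyInverseˡ index)) equation }
      where open Covered c

  stack-cong : ∀ {r k} {A A′ : Matrix r (r ℕ.+ k)} {X X′} → A ≈ A′ → X ≈ X′ → stack A X ≈ stack A′ X′
  stack-cong {r} {A = A} {A′} {X} {X′} e f = pointwise λ i → by-part (splitAt r i)
    where
    by-part : ∀ s j → [ A , X ]′ s j ≡ [ A′ , X′ ]′ s j
    by-part (inj₁ a) = at e a
    by-part (inj₂ b) = at f b

  stack-⊗ : ∀ {r k} (A : Matrix r (r ℕ.+ k)) X U → stack A X ⊗ U ≈ stack (A ⊗ U) (X ⊗ U)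
  stack-⊗ {r} A X U = pointwise λ i → by-part (splitAt r i)
    where
    by-part : ∀ s j → ([ A , X ]′ s ⊛ U) j ≡ [ A ⊗ U , X ⊗ U ]′ s j
    by-part (inj₁ a) j = refl
    by-part (inj₂ b) j = refl

  cancel-inverseʳ : ∀ {m n} {U V : Matrix n n} → Inverses U V → (M : Matrix m n) → (M ⊗ U) ⊗ V ≈ M
  cancel-inverseʳ {U = U} {V} inv M =
    ≈-trans (⊗-assoc M U V) (≈-trans (⊗-cong (≈-refl {M = M}) (invʳ inv)) (⊗-identityʳ M))

  -- Column operations act on the right and therefore commute with left multipliers: the same `W`
  -- relates two stacked matrices before and after.
  count-columns : ∀ {r k} {A B : Matrix r (r ℕ.+ k)} {d T} {U V : Matrix (r ℕ.+ k) (r ℕ.+ k)} →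
    Inverses U V → A ⊗ U ≈ B → Count B d T → Count A d T
  count-columns {r} {k} {A} {B} {d} {T} {U} {V} inv AU≈B C = record
    { rep = λ i → rep i ⊗ V
    ; solves = λ i → begin
        ∣ det (stack A (rep i ⊗ V)) ∣              ≡⟨ cong ∣_∣ (det-cong (back (rep i))) ⟨
        ∣ det (stack B (rep i) ⊗ V) ∣              ≡⟨ abs-det-⊗ (stack B (rep i)) V ⟩
        ∣ det (stack B (rep i)) ∣ ℕ.* ∣ det V ∣    ≡⟨ cong₂ ℕ._*_ (solves i) (det-invertible (inverses-sym inv)) ⟩
        d ℕ.* 1                                    ≡⟨ ℕ.*-identityʳ d ⟩
        d ∎
    ; distinct = λ i j W e → distinct i j W (≈-trans
        (⊗-cong (≈-refl {M = W}) (≈-sym (there-and-back j)))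
        (≈-trans (≈-sym (⊗-assoc W (stack A (rep j ⊗ V)) U)) (≈-trans (⊗-cong e (≈-refl {M = U})) (there-and-back i))))
    ; covers = λ X e → recover X (covers (X ⊗ U) (begin
        ∣ det (stack B (X ⊗ U)) ∣          ≡⟨ cong ∣_∣ (det-cong (forth X)) ⟨
        ∣ det (stack A X ⊗ U) ∣            ≡⟨ abs-det-⊗ (stack A X) U ⟩
        ∣ det (stack A X) ∣ ℕ.* ∣ det U ∣  ≡⟨ cong₂ ℕ._*_ e (det-invertible inv) ⟩
        d ℕ.* 1                            ≡⟨ ℕ.*-identityʳ d ⟩
        d ∎)) }
    where
    open Count C
    forth : ∀ X → stack A X ⊗ U ≈ stack B (X ⊗ U)
    forth X = ≈-trans (stack-⊗ A X U) (stack-cong AU≈B (≈-refl {M = X ⊗ U}))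
    back : ∀ Y → stack B Y ⊗ V ≈ stack A (Y ⊗ V)
    back Y = ≈-trans (stack-⊗ B Y V) (stack-cong
      (≈-trans (⊗-cong (≈-sym AU≈B) (≈-refl {M = V})) (cancel-inverseʳ inv A)) (≈-refl {M = Y ⊗ V}))
    there-and-back : ∀ i → stack A (rep i ⊗ V) ⊗ U ≈ stack B (rep i)
    there-and-back i = ≈-trans (⊗-cong (≈-sym (back (rep i))) (≈-refl {M = U}))
      (cancel-inverseʳ (inverses-sym inv) (stack B (rep i)))
    recover : ∀ X → Covered B rep (X ⊗ U) → Covered A (λ i → rep i ⊗ V) X
    recover X c = record
      { index = index
      ; inverses = inverses
      ; equation = ≈-trans (≈-sym (cancel-inverseʳ inv (stack A X)))
          (≈-trans (⊗-cong (≈-trans (forth X) equation) (≈-refl {M = V}))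
            (≈-trans (⊗-assoc mat (stack B (rep index)) V) (⊗-cong (≈-refl {M = mat}) (back (rep index))))) }
      where open Covered c using (index; mat; inverses; equation)

  -- Bordering by a row on the axis

  multiple-too-big : ∀ {a} (x : Fin a) n y → suc n ℕ.* a ℕ.+ y ≢ toℕ x
  multiple-too-big {a} x n y e = ℕ.≤⇒≯ (ℕ.≤-trans (ℕ.m≤m+n a (n ℕ.* a))
    (ℕ.≤-trans (ℕ.m≤m+n (suc n ℕ.* a) y) (ℕ.≤-reflexive e))) (toℕ<n x)

  residue-unique : ∀ {a} (x y : Fin a) u → u * ℤ.+ a + ℤ.+ toℕ y ≡ ℤ.+ toℕ x → x ≡ y
  residue-unique {a} x y (ℤ.+ zero) e = toℕ-injective (sym (+-injective (trans (sym (+-identityˡ (ℤ.+ toℕ y))) e)))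
  residue-unique {a} x y (ℤ.+ suc n) e = contradiction
    (+-injective (trans (cong (_+ ℤ.+ toℕ y) (pos-* (suc n) a)) e)) (multiple-too-big x n (toℕ y))
  residue-unique {a} x y ℤ.-[1+ n ] e = contradiction (+-injective moved) (multiple-too-big y n (toℕ x))
    where
    move : ∀ s a y → s * a + (- s * a + y) ≡ y
    move = solve-∀
    moved : ℤ.+ (suc n ℕ.* a ℕ.+ toℕ x) ≡ ℤ.+ toℕ y
    moved = trans (cong (_+ ℤ.+ toℕ x) (pos-* (suc n) a))
      (trans (cong (ℤ.+ suc n * ℤ.+ a +_) (sym e)) (move (ℤ.+ suc n) (ℤ.+ a) (ℤ.+ toℕ y)))

  lower-right : ∀ {m n} → Matrix (suc m) (suc n) → Matrix m n
  lower-right M i j = M (suc i) (suc j)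

  attach : ∀ {k n} → Vector k → Matrix k n → Matrix k (suc n)
  attach x X i zero    = x i
  attach x X i (suc j) = X i j

  -- The difference of `t` and the i-th unit vector is a relation among the rows of the nonsingular
  -- matrix `S`.
  stabiliser-row : ∀ {n} (S : Matrix n n) → det S ≢ 0ℤ → ∀ t i → (∀ j → (t ⊛ S) j ≡ S i j) → ∀ j → t j ≡ I i j
  stabiliser-row S d≢0 t i e j = difference-zero (t j) (I i j)
    (left-kernel-trivial S d≢0 (λ l → 1ℤ * t l + -1ℤ * I i l) kills j)
    where
    difference-zero : ∀ x y → 1ℤ * x + -1ℤ * y ≡ 0ℤ → x ≡ y
    difference-zero x y z = trans (restore x y) (trans (cong (_+ y) z) (+-identityˡ y))
      where
      restore : ∀ x y → x ≡ 1ℤ * x + -1ℤ * y + y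
      restore = solve-∀
    cancel : ∀ x → 1ℤ * x + -1ℤ * x ≡ 0ℤ
    cancel = solve-∀
    kills : ∀ c → ((λ l → 1ℤ * t l + -1ℤ * I i l) ⊛ S) c ≡ 0ℤ
    kills c = begin
      (λ l → 1ℤ * t l + -1ℤ * I i l) ∙ (λ l → S l c)  ≡⟨ lincomb-∙ 1ℤ -1ℤ t (I i) (λ l → S l c) ⟩
      1ℤ * (t ⊛ S) c + -1ℤ * (I i ∙ (λ l → S l c))    ≡⟨ cong₂ (λ x y → 1ℤ * x + -1ℤ * y) (e c) (∙-Iˡ i (λ l → S l c)) ⟩
      1ℤ * S i c + -1ℤ * S i c                        ≡⟨ cancel (S i c) ⟩
      0ℤ ∎

  module _ {r k : ℕ} (A : Matrix (suc r) (suc r ℕ.+ k)) (a : ℕ)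
           (axis : ∀ j → A zero j ≡ ((ℤ.+ a) ∷ᵥ 0ᵥ) j) where

    -- Below the corner, the first `r` entries are prescribed by `A` and only the last `k` are free;
    -- this is why the exponent in `a ^ k` is `k`.
    firstColumn : Matrix k (suc r ℕ.+ k) → Vector (r ℕ.+ k)
    firstColumn X i = [ (λ b → A (suc b) zero) , (λ p → X p zero) ]′ (splitAt r i)

    stack-bordered : ∀ X → stack A X ≈ bordered (ℤ.+ a) (firstColumn X) (stack (lower-right A) (tails X))
    stack-bordered X = pointwise λ where
        zero    zero    → axis zero
        zero    (suc j) → axis (suc j)
        (suc i) zero    → column (splitAt r i)
        (suc i) (suc j) → block (splitAt r i) j
      where
      column : ∀ s → [ A , X ]′ (map₁ suc s) zero ≡ [ (λ b → A (suc b) zero) , (λ p → X p zero) ]′ s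
      column (inj₁ _) = refl
      column (inj₂ _) = refl
      block : ∀ s j → [ A , X ]′ (map₁ suc s) (suc j) ≡ [ lower-right A , tails X ]′ s j
      block (inj₁ _) j = refl
      block (inj₂ _) j = refl

    abs-det-stack : ∀ X → ∣ det (stack A X) ∣ ≡ a ℕ.* ∣ det (stack (lower-right A) (tails X)) ∣
    abs-det-stack X = begin
      ∣ det (stack A X) ∣        ≡⟨ cong ∣_∣ (det-cong (stack-bordered X)) ⟩
      ∣ det (bordered (ℤ.+ a) (firstColumn X) S) ∣  ≡⟨ cong ∣_∣ (det-first-row (bordered (ℤ.+ a) (firstColumn X) S) λ _ → refl) ⟩
      ∣ ℤ.+ a * det S ∣          ≡⟨ abs-* (ℤ.+ a) (det S) ⟩
      a ℕ.* ∣ det S ∣ ∎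
      where
      S : Matrix (r ℕ.+ k) (r ℕ.+ k)
      S = stack (lower-right A) (tails X)

    module _ {d : ℕ} {T : Set} .{{_ : ℕ.NonZero a}} (d≢0 : d ≢ 0) (C : Count (lower-right A) d T) where
      open Count C

      residues : Fin (a ℕ.^ k) → Vector k
      residues f p = ℤ.+ toℕ (finToFun {a} {k} f p)

      extended : Fin (a ℕ.^ k) × T → Matrix k (suc r ℕ.+ k)
      extended (f , i) = attach (residues f) (rep i)

      nonsingular : ∀ X → ∣ det (stack (lower-right A) X) ∣ ≡ d → det (stack (lower-right A) X) ≢ 0ℤ
      nonsingular X e z = d≢0 (trans (sym e) (cong ∣_∣ z))

      -- The lower right block of `W` relates the smaller stacked matrices, which forces `i ≡ i′`.
      -- It then fixes a nonsingular matrix and is the identity, so the two first columns differ by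
      -- multiples of `a`, and residues below `a` must agree.
      extended-distinct : ∀ q q′ W → W ⊗ stack A (extended q′) ≈ stack A (extended q) → q ≡ q′
      extended-distinct (f , i) (f′ , i′) W e = same-index (distinct i i′ (lower-right W) lower-rows)
        where
        S S′ : Matrix (r ℕ.+ k) (r ℕ.+ k)
        S  = stack (lower-right A) (rep i)
        S′ = stack (lower-right A) (rep i′)
        y y′ : Vector (r ℕ.+ k)
        y  = firstColumn (extended (f , i))
        y′ = firstColumn (extended (f′ , i′))
        blocks : W ⊗ bordered (ℤ.+ a) y′ S′ ≈ bordered (ℤ.+ a) y S
        blocks = ≈-trans (⊗-cong (≈-refl {M = W}) (≈-sym (stack-bordered (extended (f′ , i′)))))
          (≈-trans e (stack-bordered (extended (f , i))))
        lower-rows : lower-right W ⊗ S′ ≈ S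
        lower-rows = pointwise λ b j → trans
          (sym (trans (cong (_+ (lower-right W ⊗ S′) b j) (*-zeroʳ (W (suc b) zero))) (+-identityˡ ((lower-right W ⊗ S′) b j))))
          (at blocks (suc b) (suc j))
        same-index : i ≡ i′ → (f , i) ≡ (f′ , i′)
        same-index refl = cong (_, i) (trans (sym (funToFin-finToFin {k} {a} f))
            (trans (funToFin-cong same-residue) (funToFin-finToFin {k} {a} f′)))
          where
          funToFin-cong : ∀ {m n} {g g′ : Fin m → Fin n} → (∀ p → g p ≡ g′ p) → funToFin g ≡ funToFin g′
          funToFin-cong {zero}  eq = refl
          funToFin-cong {suc m} eq = cong₂ Fin.combine (eq zero) (funToFin-cong (eq ∘ suc))
          identity-rows : ∀ b l → lower-right W b l ≡ I b l
          identity-rows b = stabiliser-row S (nonsingular (rep i) (solves i)) (lower-right W b) b (at lower-rows b)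
          column : ∀ b → W (suc b) zero * ℤ.+ a + y′ b ≡ y b
          column b = trans (cong (W (suc b) zero * ℤ.+ a +_)
              (sym (trans (sum-cong λ l → cong (_* y′ l) (identity-rows b l)) (∙-Iˡ b y′))))
            (at blocks (suc b) zero)
          entry : ∀ f p → firstColumn (extended (f , i)) (r ↑ʳ p) ≡ residues f p
          entry f p = cong [ (λ b → A (suc b) zero) , residues f ]′ (splitAt-↑ʳ r k p)
          same-residue : ∀ p → finToFun {a} {k} f p ≡ finToFun f′ p
          same-residue p = residue-unique (finToFun f p) (finToFun f′ p) (W (suc (r ↑ʳ p)) zero) (begin
            W (suc (r ↑ʳ p)) zero * ℤ.+ a + residues f′ p  ≡⟨ cong (W (suc (r ↑ʳ p)) zero * ℤ.+ a +_) (entry f′ p) ⟨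
            W (suc (r ↑ʳ p)) zero * ℤ.+ a + y′ (r ↑ʳ p)    ≡⟨ column (r ↑ʳ p) ⟩
            y (r ↑ʳ p)                                     ≡⟨ entry f p ⟩
            residues f p ∎)

      -- The row operation `V` that brings the smaller matrix to its representative is bordered by a
      -- column `u` of negated quotients, which reduces the free entries of the first column modulo
      -- `a`.
      extended-covers : ∀ X → ∣ det (stack (lower-right A) (tails X)) ∣ ≡ d →
        Covered (lower-right A) rep (tails X) → Covered A extended X
      extended-covers X det≡d c = record
        { index = funToFin ρ , index
        ; inverses = inverses-sym P-invertible
        ; equation = ≈-trans (≈-sym (cancel-inverse P-invertible (stack A X))) (⊗-cong (≈-refl {M = P⁻¹}) P-maps) }
        where
        open Covered c renaming (inv to V)
        S S′ : Matrix (r ℕ.+ k) (r ℕ.+ k)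
        S′ = stack (lower-right A) (tails X)
        S  = stack (lower-right A) (rep index)
        VS′≈S : V ⊗ S′ ≈ S
        VS′≈S = ≈-trans (⊗-cong (≈-refl {M = V}) equation) (cancel-inverse inverses S)
        y z u : Vector (r ℕ.+ k)
        y = firstColumn X
        z = V ⋆ y
        ρ : Fin k → Fin a
        ρ p = fromℕ< (n%ℕd<d (z (r ↑ʳ p)) a)
        -- On the rows of `A` nothing is added: both smaller matrices share these rows, so `V` acts
        -- there as the identity and the prescribed entries are already right.
        u i = [ (λ _ → 0ℤ) , (λ p → - (z (r ↑ʳ p) ℤ./ℕ a)) ]′ (splitAt r i)
        P P⁻¹ : Matrix (suc r ℕ.+ k) (suc r ℕ.+ k)
        P   = bordered 1ℤ u V
        P⁻¹ = bordered 1ℤ (λ i → - (1ℤ * (mat ⋆ u) i)) mat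
        P-invertible : Inverses P P⁻¹
        P-invertible = inverses-bordered {s = 1ℤ} u refl (inverses-sym inverses)
        subtract : ∀ x q s → - q * x + (s + q * x) ≡ s
        subtract = solve-∀
        lifted : Vector (r ℕ.+ k)
        lifted = firstColumn (extended (funToFin ρ , index))
        column : ∀ i → u i * ℤ.+ a + z i ≡ lifted i
        column i = by-part (splitAt r i) refl
          where
          by-part : ∀ s → splitAt r i ≡ s →
            [ (λ _ → 0ℤ) , (λ p → - (z (r ↑ʳ p) ℤ./ℕ a)) ]′ s * ℤ.+ a + z i
              ≡ [ (λ b → A (suc b) zero) , (λ p → residues (funToFin ρ) p) ]′ s
          by-part (inj₁ b) eq = begin
            0ℤ * ℤ.+ a + z i   ≡⟨ +-identityˡ (z i) ⟩
            V i ∙ y            ≡⟨ sum-cong (λ l → cong (_* y l) (identity-row l)) ⟩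
            I i ∙ y            ≡⟨ ∙-Iˡ i y ⟩
            y i                ≡⟨ cong [ (λ b → A (suc b) zero) , (λ p → X p zero) ]′ eq ⟩
            A (suc b) zero ∎
            where
            same-row : ∀ j → (V i ⊛ S′) j ≡ S′ i j
            same-row j = trans (at VS′≈S i j) (trans (cong (λ s → [ lower-right A , rep index ]′ s j) eq)
              (sym (cong (λ s → [ lower-right A , tails X ]′ s j) eq)))
            identity-row : ∀ l → V i l ≡ I i l
            identity-row = stabiliser-row S′ (nonsingular (tails X) det≡d) (V i) i same-row
          by-part (inj₂ p) eq with refl ← splitAt⁻¹-↑ʳ {r} {k} {i} eq = begin
            - q * ℤ.+ a + z i                            ≡⟨ cong (- q * ℤ.+ a +_) (a≡a%ℕn+[a/ℕn]*n (z i) a) ⟩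
            - q * ℤ.+ a + (ℤ.+ (z i ℤ.%ℕ a) + q * ℤ.+ a) ≡⟨ subtract (ℤ.+ a) q (ℤ.+ (z i ℤ.%ℕ a)) ⟩
            ℤ.+ (z i ℤ.%ℕ a)                             ≡⟨ cong ℤ.+_ (toℕ-fromℕ< (n%ℕd<d (z i) a)) ⟨
            ℤ.+ toℕ (ρ p)                                ≡⟨ cong (ℤ.+_ ∘ toℕ) (finToFun-funToFin ρ p) ⟨
            residues (funToFin ρ) p ∎
            where
            q : ℤ
            q = z i ℤ./ℕ a
        P-maps : P ⊗ stack A X ≈ stack A (extended (funToFin ρ , index))
        P-maps = ≈-trans (⊗-cong (≈-refl {M = P}) (stack-bordered X))
          (≈-trans (bordered-⊗ 1ℤ (ℤ.+ a) u y V S′)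
            (≈-trans (bordered-cong (*-identityˡ (ℤ.+ a)) column VS′≈S)
              (≈-sym (stack-bordered (extended (funToFin ρ , index))))))

      count-border : Count A (a ℕ.* d) (Fin (a ℕ.^ k) × T)
      count-border = record
        { rep = extended
        ; solves = λ q → trans (abs-det-stack (extended q)) (cong (a ℕ.*_) (solves (proj₂ q)))
        ; distinct = extended-distinct
        ; covers = λ X e → let det≡d = ℕ.*-cancelˡ-≡ _ d a (trans (sym (abs-det-stack X)) e) in
            extended-covers X det≡d (covers (tails X) det≡d) }

  -- Nonsingular square matrices

  -- Presents a square matrix whose first row is on the axis as a completion of a one-row matrix, to
  -- which `count-border` applies.
  axisRow : ∀ {k} → ℕ → Matrix 1 (1 ℕ.+ k)
  axisRow g _ = (ℤ.+ g) ∷ᵥ 0ᵥ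

  -- Up to left multiplication by a unimodular matrix, the first row of a nonsingular square matrix
  -- is (g, 0, …, 0) for exactly one g > 0.
  module _ {k m : ℕ} {S : Set} {T : S → Set} (g : S → ℕ) (m≢0 : m ≢ 0)
           (g-injective : ∀ {s s′} → g s ≡ g s′ → s ≡ s′) (g-complete : ∀ h → h ∣ℕ m → ∃[ s ] g s ≡ h)
           (C : ∀ s → Count {1} {k} (axisRow (g s)) m (T s)) where

    square-rep : Σ S T → Matrix (suc k) (suc k)
    square-rep (s , x) = stack {1} (axisRow (g s)) (Count.rep (C s) x)

    -- Nonsingularity of `S′` forces the first row of `W` onto the axis, so h is `W zero zero` times
    -- h′. Equal nonzero determinants give `∣ det W ∣ ≡ 1`, and `W zero zero` divides `det W`, hence
    -- is a unit.
    corner-invariant : ∀ {h h′} (Y Y′ : Matrix k (suc k)) W →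
      ∣ det (stack {1} (axisRow h) Y) ∣ ≡ m → ∣ det (stack {1} (axisRow h′) Y′) ∣ ≡ m →
      W ⊗ stack {1} (axisRow h′) Y′ ≈ stack {1} (axisRow h) Y → h ≡ h′
    corner-invariant {h} {h′} Y Y′ W det-M det-M′ e = begin
      h                            ≡⟨ cong ∣_∣ corner ⟨
      ∣ W zero zero * ℤ.+ h′ ∣     ≡⟨ abs-* (W zero zero) (ℤ.+ h′) ⟩
      ∣ W zero zero ∣ ℕ.* h′       ≡⟨ cong (ℕ._* h′) corner-unit ⟩
      1 ℕ.* h′                     ≡⟨ ℕ.*-identityˡ h′ ⟩
      h′ ∎
      where
      instance
        m-nonZero : ℕ.NonZero m
        m-nonZero = ℕ.≢-nonZero m≢0
      S′ : Matrix k k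
      S′ = stack {0} (λ ()) (tails Y′)
      y′ : Vector k
      y′ = firstColumn (axisRow h′) h′ (λ _ → refl) Y′
      blocks : W ⊗ bordered (ℤ.+ h′) y′ S′ ≈ stack {1} (axisRow h) Y
      blocks = ≈-trans (⊗-cong (≈-refl {M = W}) (≈-sym (stack-bordered (axisRow h′) h′ (λ _ → refl) Y′))) e
      S′-nonsingular : det S′ ≢ 0ℤ
      S′-nonsingular z = m≢0 (begin
        m                                      ≡⟨ det-M′ ⟨
        ∣ det (stack {1} (axisRow h′) Y′) ∣    ≡⟨ abs-det-stack (axisRow h′) h′ (λ _ → refl) Y′ ⟩
        h′ ℕ.* ∣ det S′ ∣                      ≡⟨ cong (λ x → h′ ℕ.* ∣ x ∣) z ⟩
        h′ ℕ.* 0                               ≡⟨ ℕ.*-zeroʳ h′ ⟩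
        0 ∎)
      w≡0 : ∀ l → W zero (suc l) ≡ 0ℤ
      w≡0 = left-kernel-trivial S′ S′-nonsingular (W zero ∘ suc) λ j → begin
        ((W zero ∘ suc) ⊛ S′) j                          ≡⟨ +-identityˡ (((W zero ∘ suc) ⊛ S′) j) ⟨
        0ℤ + ((W zero ∘ suc) ⊛ S′) j                     ≡⟨ cong (_+ ((W zero ∘ suc) ⊛ S′) j) (*-zeroʳ (W zero zero)) ⟨
        W zero zero * 0ℤ + ((W zero ∘ suc) ⊛ S′) j       ≡⟨ at blocks zero (suc j) ⟩
        0ℤ ∎
      corner : W zero zero * ℤ.+ h′ ≡ ℤ.+ h
      corner = begin
        W zero zero * ℤ.+ h′                             ≡⟨ +-identityʳ (W zero zero * ℤ.+ h′) ⟨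
        W zero zero * ℤ.+ h′ + 0ℤ                        ≡⟨ cong (W zero zero * ℤ.+ h′ +_) (∙-zeroˡ w≡0 y′) ⟨
        W zero zero * ℤ.+ h′ + (W zero ∘ suc) ∙ y′       ≡⟨ at blocks zero zero ⟩
        ℤ.+ h ∎
      det-W : ∣ det W ∣ ≡ 1
      det-W = ℕ.*-cancelʳ-≡ ∣ det W ∣ 1 m (begin
        ∣ det W ∣ ℕ.* m                                              ≡⟨ cong (∣ det W ∣ ℕ.*_) det-M′ ⟨
        ∣ det W ∣ ℕ.* ∣ det (stack {1} (axisRow h′) Y′) ∣            ≡⟨ abs-det-⊗ W (stack {1} (axisRow h′) Y′) ⟨
        ∣ det (W ⊗ stack {1} (axisRow h′) Y′) ∣                      ≡⟨ cong ∣_∣ (det-cong e) ⟩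
        ∣ det (stack {1} (axisRow h) Y) ∣                            ≡⟨ det-M ⟩
        m                                                            ≡⟨ ℕ.*-identityˡ m ⟨
        1 ℕ.* m ∎)
      corner-unit : ∣ W zero zero ∣ ≡ 1
      corner-unit = ℕ.m*n≡1⇒m≡1 ∣ W zero zero ∣ ∣ det (lower-right W) ∣ (begin
        ∣ W zero zero ∣ ℕ.* ∣ det (lower-right W) ∣  ≡⟨ abs-* (W zero zero) (det (lower-right W)) ⟨
        ∣ W zero zero * det (lower-right W) ∣        ≡⟨ cong ∣_∣ (det-first-row W w≡0) ⟨
        ∣ det W ∣                                    ≡⟨ det-W ⟩
        1 ∎)

    square-covers : ∀ (A : Matrix 0 (suc k)) X → ∣ det X ∣ ≡ m → Covered A square-rep X
    square-covers A X e = from-split (g-complete corner corner∣m)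
      where
      open FirstRowAxis (first-row-axis X) renaming (mat to W; inv to V)
      Y : Matrix k (suc k)
      Y i = (W ⊗ X) (suc i)
      WX≈ : W ⊗ X ≈ stack {1} (axisRow corner) Y
      WX≈ = pointwise λ { zero → axis ; (suc i) j → refl }
      det≡m : ∣ det (stack {1} (axisRow corner) Y) ∣ ≡ m
      det≡m = begin
        ∣ det (stack {1} (axisRow corner) Y) ∣  ≡⟨ cong ∣_∣ (det-cong WX≈) ⟨
        ∣ det (W ⊗ X) ∣                         ≡⟨ abs-det-⊗ W X ⟩
        ∣ det W ∣ ℕ.* ∣ det X ∣                 ≡⟨ cong₂ ℕ._*_ (det-invertible inverses) e ⟩
        1 ℕ.* m                                 ≡⟨ ℕ.*-identityˡ m ⟩
        m ∎
      corner∣m : corner ∣ℕ m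
      corner∣m = divides rest (trans (sym det≡m) (trans (abs-det-stack (axisRow corner) corner (λ _ → refl) Y) (ℕ.*-comm corner rest)))
        where
        rest : ℕ
        rest = ∣ det (stack {0} (lower-right (axisRow corner)) (tails Y)) ∣
      compose : ∀ s → stack {1} (axisRow (g s)) Y ≈ W ⊗ X → Covered (axisRow (g s)) (Count.rep (C s)) Y → Covered A square-rep X
      compose s f c = record
        { index = s , Covered.index c
        ; inverses = inverses-⊗ (inverses-sym inverses) (Covered.inverses c)
        ; equation = ≈-trans (≈-sym (cancel-inverse inverses X))
            (≈-trans (⊗-cong (≈-refl {M = V}) (≈-trans (≈-sym f) (Covered.equation c)))
              (≈-sym (⊗-assoc V (Covered.mat c) (stack {1} (axisRow (g s)) (Count.rep (C s) (Covered.index c)))))) }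
      from-split : ∃[ s ] g s ≡ corner → Covered A square-rep X
      from-split (s , gs≡corner) = compose s
        (subst (λ h → stack {1} (axisRow h) Y ≈ W ⊗ X) (sym gs≡corner) (≈-sym WX≈))
        (Count.covers (C s) Y (subst (λ h → ∣ det (stack {1} (axisRow h) Y) ∣ ≡ m) (sym gs≡corner) det≡m))

    count-square : ∀ A → Count {0} {suc k} A m (Σ S T)
    count-square A = record
      { rep = square-rep
      ; solves = λ (s , x) → Count.solves (C s) x
      ; distinct = separate
      ; covers = square-covers A }
      where
      separate : ∀ q q′ W → W ⊗ square-rep q′ ≈ square-rep q → q ≡ q′
      separate (s , x) (s′ , x′) W e = same-corner (g-injective
          (corner-invariant (Count.rep (C s) x) (Count.rep (C s′) x′) W (Count.solves (C s) x) (Count.solves (C s′) x′) e))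
        where
        same-corner : s ≡ s′ → (s , x) ≡ (s′ , x′)
        same-corner refl = cong (s ,_) (Count.distinct (C s) x x′ W e)

  count-empty : ∀ {v n} (A : Matrix 0 0) → (v ≡ 1 × n ≡ 1) ⊎ (v ≢ 1 × n ≡ 0) → Count {0} {0} A v (Fin n)
  count-empty A (inj₁ (refl , refl)) = record
    { rep = λ _ ()
    ; solves = λ _ → refl
    ; distinct = λ { zero zero _ _ → refl }
    ; covers = λ X _ → record { index = zero ; inverses = inverses-I ; equation = pointwise λ () } }
  count-empty A (inj₂ (v≢1 , refl)) = record
    { rep = λ ()
    ; solves = λ ()
    ; distinct = λ ()
    ; covers = λ X e → contradiction (sym e) v≢1 }

  Fin-cong : ∀ {m n} → m ≡ n → Fin m ↔ Fin n
  Fin-cong refl = ↔-id _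

  module _ {l} (p : Fin l → ℕ) (p-prime : ∀ i → Prime (p i)) (p-injective : ∀ {i j} → p i ≡ p j → i ≡ j) where

    -- The left part of a splitting is the corner and the right part is the determinant of the
    -- remaining block; `subgroups-splits` adds up the resulting counts.
    count-nonsingular : ∀ k es (A : Matrix 0 k) → Count {0} {k} A (value p es) (Fin (subgroups p k es))
    count-nonsingular zero    es A = count-empty A (subgroups-zero p p-prime es)
    count-nonsingular (suc k) es A = count-reindex
      (↔-sym (Fin-cong (subgroups-splits p k es) ↔-∘ Σ-Split↔ es {F}))
      (count-square corner (value-nonzero p p-prime es) (split-unique p p-prime p-injective es _ _) complete with-corner A)
      where
      corner : Split es → ℕ
      corner s = value p (left es s)
      F : Split es → ℕ
      F s = corner s ℕ.^ k ℕ.* subgroups p k (right es s)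
      complete : ∀ h → h ∣ℕ value p es → ∃[ s ] corner s ≡ h
      complete h (divides q eq) with s , e , _ ← factor-split p p-prime es h q (trans (ℕ.*-comm h q) (sym eq)) = s , e
      with-corner : ∀ s → Count {1} {k} (axisRow (corner s)) (value p es) (Fin (F s))
      with-corner s = count-reindex *↔× (subst (λ d → Count (axisRow (corner s)) d (Fin (corner s ℕ.^ k) × Fin (subgroups p k (right es s)))) (value-split p es s)
        (count-border (axisRow (corner s)) (corner s) (λ _ → refl)
          {{ℕ.≢-nonZero (value-nonzero p p-prime (left es s))}}
          (value-nonzero p p-prime (right es s)) (count-nonsingular k (right es s) (lower-right (axisRow (corner s))))))

  -- Greatest divisors and the induction on the rows of `A`

  -- A minor of `A ⊗ U` is the determinant of `A` times some columns of `U`, so common divisors of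
  -- the minors of `A` divide it. The converse is the same argument for `A ⊗ U` and the inverse `V`.
  isDelta-⊗ : ∀ {r n} (A : Matrix r n) {δ} {U V} → Inverses U V → IsDelta A δ → IsDelta (A ⊗ U) δ
  isDelta-⊗ A {δ} {U} {V} inv (divides-minors , greatest) =
    (λ c → ∣⇒∣ᵤ (minors-divide {A = A} {ℤ.+ δ} (λ c′ → ∣ᵤ⇒∣ (divides-minors c′)) (λ l j → U l (proj₁ c j)))) ,
    (λ g h → greatest g λ c → ∣⇒∣ᵤ (subst (ℤ.+ g ∣_)
      (det-cong (pointwise λ i j → at (cancel-inverseʳ inv A) i (proj₁ c j)))
      (minors-divide {A = A ⊗ U} {ℤ.+ g} (λ c′ → ∣ᵤ⇒∣ (h c′)) (λ l j → V l (proj₁ c j)))))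

  module _ {r n} (B : Matrix (suc r) (suc n)) (a : ℕ) (axis : ∀ j → B zero j ≡ ((ℤ.+ a) ∷ᵥ 0ᵥ) j) where

    minor-consChoice : ∀ c → ∣ minor B (consChoice c) ∣ ≡ a ℕ.* ∣ minor (lower-right B) c ∣
    minor-consChoice c = begin
      ∣ minor B (consChoice c) ∣                     ≡⟨ cong ∣_∣ (det-first-row (λ i j → B i (proj₁ (consChoice c) j)) (λ j → axis (suc (proj₁ c j)))) ⟩
      ∣ B zero zero * minor (lower-right B) c ∣      ≡⟨ cong (λ b → ∣ b * minor (lower-right B) c ∣) (axis zero) ⟩
      ∣ ℤ.+ a * minor (lower-right B) c ∣            ≡⟨ abs-* (ℤ.+ a) (minor (lower-right B) c) ⟩
      a ℕ.* ∣ minor (lower-right B) c ∣ ∎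

    minor-shiftChoice : ∀ c → minor B (shiftChoice c) ≡ 0ℤ
    minor-shiftChoice c = trans
      (det-first-row (λ i j → B i (suc (proj₁ c j))) (λ j → axis (suc (proj₁ c (suc j)))))
      (cong (_* det (λ i j → B (suc i) (suc (proj₁ c (suc j))))) (axis (suc (proj₁ c zero))))

    -- A choice containing column zero gives `a` times a minor of the lower right block up to sign,
    -- and any other choice gives 0, so the former decide all divisibilities.
    minors-multiple : ∀ {g} → (∀ c → g ∣ℕ a ℕ.* ∣ minor (lower-right B) c ∣) → ∀ c → g ∣ℕ ∣ minor B c ∣
    minors-multiple {g} h c = by-view (choice-view c)
      where
      same-columns : ∀ c′ → (∀ i → proj₁ c i ≡ proj₁ c′ i) → minor B c′ ≡ minor B c
      same-columns c′ e = det-cong (pointwise λ i j → cong (B i) (sym (e j)))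
      by-view : (∃[ c′ ] ∀ i → proj₁ c i ≡ proj₁ (consChoice {r} {n} c′) i) ⊎
                (∃[ c′ ] ∀ i → proj₁ c i ≡ proj₁ (shiftChoice {suc r} {n} c′) i) → g ∣ℕ ∣ minor B c ∣
      by-view (inj₁ (c′ , e)) = subst (g ∣ℕ_)
        (trans (sym (minor-consChoice c′)) (cong ∣_∣ (same-columns (consChoice c′) e))) (h c′)
      by-view (inj₂ (c′ , e)) = subst (g ∣ℕ_)
        (cong ∣_∣ (trans (sym (minor-shiftChoice c′)) (same-columns (shiftChoice c′) e))) (g ℕ∣.∣0)

    isDelta-lower-right : ∀ {δ} → δ ≢ 0 → IsDelta B δ → ∃[ δ′ ] δ ≡ a ℕ.* δ′ × IsDelta (lower-right B) δ′
    isDelta-lower-right {δ} δ≢0 (divides-minors , greatest) =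
      factor (greatest a (minors-multiple λ c → ℕ∣.m∣m*n ∣ minor (lower-right B) c ∣))
      where
      factor : a ∣ℕ δ → ∃[ δ′ ] δ ≡ a ℕ.* δ′ × IsDelta (lower-right B) δ′
      factor (divides δ′ δ≡δ′a) = δ′ , δ≡aδ′ ,
        (λ c → ℕ∣.*-cancelˡ-∣ a (subst₂ _∣ℕ_ δ≡aδ′ (minor-consChoice c) (divides-minors (consChoice c)))) ,
        (λ g h → ℕ∣.*-cancelˡ-∣ a (subst (a ℕ.* g ∣ℕ_) δ≡aδ′ (greatest (a ℕ.* g) (minors-multiple λ c → ℕ∣.*-monoʳ-∣ a (h c)))))
        where
        δ≡aδ′ : δ ≡ a ℕ.* δ′
        δ≡aδ′ = trans δ≡δ′a (ℕ.*-comm δ′ a)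
        instance
          a-nonZero : ℕ.NonZero a
          a-nonZero = ℕ.≢-nonZero λ a≡0 → δ≢0 (trans δ≡aδ′ (cong (ℕ._* δ′) a≡0))

  module _ (k : ℕ) {m N : ℕ} (m≢0 : m ≢ 0) (squares : ∀ A → Count {0} {k} A m (Fin N)) where

    -- The quotient `m` of the determinant by `δ` stays fixed through the induction, while each row
    -- of `A` splits its `scale` off `δ`. When the rows are used up, the determinant is `m` itself.
    count-solutions : ∀ r (A : Matrix r (r ℕ.+ k)) δ → δ ≢ 0 → IsDelta A δ → Count A (m ℕ.* δ) (Fin (δ ℕ.^ k ℕ.* N))
    count-solutions zero A δ δ≢0 (divides-minors , _) = subst (λ δ → Count A (m ℕ.* δ) (Fin (δ ℕ.^ k ℕ.* N))) (sym δ≡1)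
      (subst₂ (λ d n → Count A d (Fin n)) (sym (ℕ.*-identityʳ m))
        (sym (trans (cong (ℕ._* N) (ℕ.^-zeroˡ k)) (ℕ.*-identityˡ N))) (squares A))
      where
      δ≡1 : δ ≡ 1
      -- With no rows, the only minor is the empty determinant 1.
      δ≡1 = ℕ∣.∣1⇒≡1 (divides-minors ((λ ()) , λ ()))
    count-solutions (suc r) A δ δ≢0 Δ = from-lower (isDelta-lower-right (A ⊗ U) scale axis δ≢0 (isDelta-⊗ A inverses Δ))
      where
      open PrimitiveRow (primitive-row (A zero))
      from-lower : (∃[ δ′ ] δ ≡ scale ℕ.* δ′ × IsDelta (lower-right (A ⊗ U)) δ′) → Count A (m ℕ.* δ) (Fin (δ ℕ.^ k ℕ.* N))
      from-lower (δ′ , refl , Δ′) = count-columns inverses (≈-refl {M = A ⊗ U})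
        (subst₂ (Count (A ⊗ U)) (reorder scale m δ′) refl
          (count-reindex (*↔× ↔-∘ Fin-cong size)
            (count-border (A ⊗ U) scale axis {{ℕ.≢-nonZero scale≢0}} (λ z → [ m≢0 , δ′≢0 ]′ (ℕ.m*n≡0⇒m≡0∨n≡0 m z))
              (count-solutions r (lower-right (A ⊗ U)) δ′ δ′≢0 Δ′))))
        where
        scale≢0 : scale ≢ 0
        scale≢0 z = δ≢0 (cong (ℕ._* δ′) z)
        δ′≢0 : δ′ ≢ 0
        δ′≢0 z = δ≢0 (trans (cong (scale ℕ.*_) z) (ℕ.*-zeroʳ scale))
        reorder : ∀ a m d → a ℕ.* (m ℕ.* d) ≡ m ℕ.* (a ℕ.* d)
        reorder = solve-∀ℕ
        size : (scale ℕ.* δ′) ℕ.^ k ℕ.* N ≡ scale ℕ.^ k ℕ.* (δ′ ℕ.^ k ℕ.* N)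
        size = trans (cong (ℕ._* N) (^-distribʳ-* k scale δ′)) (ℕ.*-assoc (scale ℕ.^ k) (δ′ ℕ.^ k) N)

  abs≡⇒± : ∀ {z n} → ∣ z ∣ ≡ n → z ≡ ℤ.+ n ⊎ z ≡ - (ℤ.+ n)
  abs≡⇒± {ℤ.+ _}      refl = inj₁ refl
  abs≡⇒± {ℤ.-[1+ _ ]} refl = inj₂ refl

  ±⇒abs≡ : ∀ {z n} → z ≡ ℤ.+ n ⊎ z ≡ - (ℤ.+ n) → ∣ z ∣ ≡ n
  ±⇒abs≡         (inj₁ refl) = refl
  ±⇒abs≡ {n = n} (inj₂ refl) = ∣-i∣≡∣i∣ (ℤ.+ n)

  count⇒numClasses : ∀ {r k} {A : Matrix r (r ℕ.+ k)} {d N} → Count A d (Fin N) → NumClasses A d N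
  count⇒numClasses C = rep , (λ i → abs≡⇒± (solves i)) ,
    (λ i j (W , _ , e) → distinct i j W (≈-sym (pointwise e))) ,
    (λ X s → let open Covered (covers X (±⇒abs≡ s)) in index , mat , abs≡⇒± (det-invertible inverses) , at equation)
    where open Count C

open import Data.Nat using (ℕ; _+_; _^_; _*_; _<_; _≤_)
open import Data.Nat.Divisibility using (_∣_)
open import Data.Nat.Primality using (Prime)
open import Data.Nat.Properties using (*-zeroʳ; >⇒≢)
open import Data.Fin using (Fin)
open import Data.Vec using (tabulate)
open import Function.Definitions using (Injective)
open import Relation.Binary.PropositionalEquality using (_≡_; _≢_; sym; trans; cong; subst₂)
open Factorisations using (value-nonzero; value-tabulate; subgroups-tabulate)
open Classes using (count-solutions; count-nonsingular; count⇒numClasses)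

theorem5p4 : (r k : ℕ) → 1 ≤ k → (A : Matrix r (r + k)) → FullRank A →
    (δ : ℕ) → IsDelta A δ → (d : ℕ) → 0 < d → δ ∣ d →
    (l : ℕ) (p e : Fin l → ℕ) → (∀ i → Prime (p i)) → Injective _≡_ _≡_ p →
    (∀ i → 1 ≤ e i) → d ≡ prodℕ (λ i → p i ^ e i) * δ →
    NumClasses A d (countFormula δ k l p e)
theorem5p4 r k _ A _ δ Δ d 0<d _ l p e p-prime p-injective _ d≡ = subst₂ (NumClasses A)
  (trans (cong (_* δ) (value-tabulate p e)) (sym d≡))
  (cong (δ ^ k *_) (subgroups-tabulate p e k))
  (count⇒numClasses (count-solutions k (value-nonzero p p-prime (tabulate e))
    (count-nonsingular p p-prime p-injective k (tabulate e)) r A δ δ≢0 Δ))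
  where
  δ≢0 : δ ≢ 0
  δ≢0 δ≡0 = >⇒≢ 0<d (trans d≡ (trans (cong (prodℕ (λ i → p i ^ e i) *_) δ≡0) (*-zeroʳ (prodℕ (λ i → p i ^ e i)))))
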